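{- Let $x,y$ be nonnegative integers, $k$ an integer, and $W\subseteq[x+y]=\{1,\dots,x+y\}$. Then $S_{x,y}(\overline W)$ has no lozenge tiling unless $|W|=y$, and if $|W|=y$, \[\operatorname{M}_{(q,X,Y,k)}(S_{x,y}(\overline{W}))=\frac{\Delta_{1,1,(q,X,Y,k)}(W)}{\prod_{i=1}^{y-1}\langle i\rangle_{q}!},\] where $\Delta_{1,1,(q,X,Y,k)}(W)=\prod_{w_1,w_2\in W,\,w_1<w_2}\left[\frac{q^{(w_1+w_2+k)-(x+y+1)}X+q^{ -((w_1+w_2+k)-(x+y+1))}Y}{2}\right]\langle w_2-w_1\rangle_q$.
   Context: Triangular lattice of unit triangles (side $1$) with one family of lattice lines vertical; left-pointing unit triangles have a vertical side on their right. A lozenge is a union of two unit triangles sharing an edge; horizontal if the shared edge is vertical. $S_{x,y}$ is the trapezoid whose sides, clockwise from the vertical left side, have lengths $x$, $y$, $x+y$, $y$; label the unit segments of its right side $-\frac{x+y-1}{2},\dots,\frac{x+y-1}{2}$ from bottom to top. $S_{x,y}(\overline W)$ is obtained by deleting the left-pointing unit triangles whose right sides are the right-boundary segments labeled by elements of $W-\frac{x+y+1}{2}=\{w-\frac{x+y+1}{2}:w\in W\}$ (i.e. the $w$-th segments from the bottom, $w\in W$). Weights: define the $i$-coordinate of a point as $k$ plus twice its signed vertical distance above the perpendicular bisector of the left side (so that bisector is the line $i=k$); a horizontal lozenge whose center has $i$-coordinate $n$ gets weight $\frac{Xq^n+Yq^{ -n}}{2}$, all other lozenges weight $1$; $\operatorname{M}_{(q,X,Y,k)}$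 is the sum over lozenge tilings of the product of weights. $\langle n\rangle_q=\frac{q^n-q^{ -n}}{q-q^{ -1}}$, $\langle n\rangle_q!=\langle1\rangle_q\cdots\langle n\rangle_q$.
   Formalization: The degenerate case y = 0 with W nonempty is excluded: there the region has no area and contains no triangles to delete, so it has the empty tiling although |W| ≠ y. -}

module Defs where

open import Level using (Level)
open import Data.Nat as ℕ using (ℕ; zero; suc; _∸_; _<?_; _≡ᵇ_)
open import Data.Integer as ℤ using (ℤ; +_; -[1+_])
open import Data.Bool using (Bool; true; false; if_then_else_)
open import Data.Fin using (Fin; toℕ; fromℕ<)
open import Data.Fin.Subset using (Subset)
open import Data.Fin.Subset.Properties using () renaming (_∈?_ to _∈ˢ?_)
open import Data.Vec using (lookup)
open import Data.List using (List; []; _∷_; map; concat; concatMap; upTo; filter; _++_; foldr; allFin)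
open import Data.List.Relation.Unary.All using (All; all?)
open import Data.List.Relation.Unary.Unique.Propositional using (Unique)
open import Data.List.Membership.Propositional using (_∈_)
open import Data.List.Membership.DecPropositional using ()
open import Data.Maybe using (Maybe; just; nothing)
open import Data.Product using (_×_; _,_; ∃)
open import Data.Product.Properties using (≡-dec)
open import Relation.Nullary using (¬_; Dec; yes; no; does; _×-dec_)
open import Relation.Binary.PropositionalEquality using (_≡_)
open import Algebra.Bundles using (CommutativeRing)
import Data.List.Relation.Unary.Unique.DecPropositional as UDec
import Data.List.Membership.DecPropositional as MDec

-- Coordinates.  The vertical lattice lines of S_{x,y} are
-- lines 0..y (line 0 = left side, of length x; line c has length x+c,
-- centred at height 0).  Column c (between lines c and c+1), c < y, contains
--   * right-pointing triangles R(c,s), s < x+c, whose left (vertical) side is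
--     the s-th unit segment (from the bottom, 0-based) of line c;
--   * left-pointing triangles  L(c,t), t < x+c+1, whose right (vertical) side
--     is the t-th unit segment of line c+1.
-- Adjacencies: R(c,s) shares its slanted edges with L(c,s) (below) and
-- L(c,s+1) (above), and its vertical edge with L(c-1,s) (if c ≥ 1).
-- Every lozenge consists of exactly one R- and one L-triangle.

Cell : Set
Cell = ℕ × ℕ

RTris : ℕ → ℕ → List Cell
RTris x y = concatMap (λ c → map (c ,_) (upTo (x ℕ.+ c))) (upTo y)

LTrisAll : ℕ → ℕ → List Cell
LTrisAll x y = concatMap (λ c → map (c ,_) (upTo (suc (x ℕ.+ c)))) (upTo y)

-- L(c,t) is deleted in S_{x,y}(W̄) iff its right side is the (t+1)-st
-- segment from the bottom of the right side (line y) and t+1 ∈ W.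
-- W ⊆ [x+y] is a Subset (x+y); Fin index i stands for the integer i+1.
deleted : (x y : ℕ) → Subset (x ℕ.+ y) → Cell → Bool
deleted x y W (c , t) with suc c ≡ᵇ y | t <? (x ℕ.+ y)
... | true  | yes p = does (fromℕ< p ∈ˢ? W)
... | _     | _     = false

LTris : (x y : ℕ) → Subset (x ℕ.+ y) → List Cell
LTris x y W = filter (λ l → Data.Bool._≟_ (deleted x y W l) false) (LTrisAll x y)
  where import Data.Bool

-- Tilings.  A lozenge tiling is determined by, for each right-pointing
-- triangle, the lozenge containing it: which neighbour it is paired with.

data Dir : Set where
  hor down up : Dir   -- hor = horizontal lozenge (shared edge vertical)

partner : Cell → Dir → Maybe Cell
partner (zero  , s) hor  = nothing
partner (suc c , s) hor  = just (c , s)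
partner (c , s)     down = just (c , s)
partner (c , s)     up   = just (c , suc s)

partners : List Cell → List Dir → Maybe (List Cell)
partners []       []       = just []
partners (r ∷ rs) (d ∷ ds) with partner r d | partners rs ds
... | just l  | just ls = just (l ∷ ls)
... | _       | _       = nothing
partners _        _        = nothing

GoodPairing : List Cell → List Cell → Set
GoodPairing Ls ps = All (_∈ Ls) ps × Unique ps × All (_∈ ps) Ls

goodPairing? : (Ls ps : List Cell) → Dec (GoodPairing Ls ps)
goodPairing? Ls ps =
  all? (_∈? Ls) ps ×-dec (UDec.unique? _≟c_ ps ×-dec all? (_∈? ps) Ls)
  where
    _≟c_ = ≡-dec ℕ._≟_ ℕ._≟_
    open MDec _≟c_ using (_∈?_)

IsTiling : (x y : ℕ) → Subset (x ℕ.+ y) → List Dir → Set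
IsTiling x y W ch =
  ∃ λ ps → partners (RTris x y) ch ≡ just ps × GoodPairing (LTris x y W) ps

allDirs : ℕ → List (List Dir)
allDirs zero    = [] ∷ []
allDirs (suc n) = concatMap (λ d → map (d ∷_) (allDirs n)) (hor ∷ down ∷ up ∷ [])

len : {A : Set} → List A → ℕ
len = Data.List.length
  where import Data.List

-- Weighted quantities in a commutative ring R, given q with inverse qi
-- (q * qi ≈ 1) and h playing the role of 1/2 (h + h ≈ 1).

module _ {c ℓ : Level} (R : CommutativeRing c ℓ) where
  open CommutativeRing R

  npow : Carrier → ℕ → Carrier
  npow a zero    = 1#
  npow a (suc n) = a * npow a n

  zpow : (q qi : Carrier) → ℤ → Carrier
  zpow q qi (+ n)    = npow q n
  zpow q qi -[1+ n ] = npow qi (suc n)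

  prod : List Carrier → Carrier
  prod = foldr _*_ 1#

  sumR : List Carrier → Carrier
  sumR = foldr _+_ 0#

  -- ⟨n⟩_q = (q^n - q^{-n})/(q - q^{-1}) = Σ_{j<n} q^{n-1-2j}
  qint : (q qi : Carrier) → ℕ → Carrier
  qint q qi n = sumR (map (λ j → zpow q qi ((+ n) ℤ.- (+ 1) ℤ.- (+ 2) ℤ.* (+ j))) (upTo n))

  qfact : (q qi : Carrier) → ℕ → Carrier
  qfact q qi n = prod (map (λ i → qint q qi (suc i)) (upTo n))

  hw : (q qi h X Y : Carrier) → ℤ → Carrier
  hw q qi h X Y n = h * (X * zpow q qi n + Y * zpow q qi (ℤ.- n))

  -- weight of the lozenge containing R(c,s) in direction d: a horizontal
  -- lozenge L(c-1,s) ∪ R(c,s) has its centre at the midpoint of the s-th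
  -- segment of line c, at height -(x+c)/2 + s + 1/2, so its i-coordinate
  -- is k + 2s + 1 - x - c.
  lozW : (q qi h X Y : Carrier) (k : ℤ) (x : ℕ) → Cell → Dir → Carrier
  lozW q qi h X Y k x (c , s) hor  =
    hw q qi h X Y (k ℤ.+ (+ (2 ℕ.* s ℕ.+ 1)) ℤ.- (+ x) ℤ.- (+ c))
  lozW q qi h X Y k x (c , s) down = 1#
  lozW q qi h X Y k x (c , s) up   = 1#

  weightOf : (q qi h X Y : Carrier) (k : ℤ) (x : ℕ) → List Cell → List Dir → Carrier
  weightOf q qi h X Y k x []       _        = 1#
  weightOf q qi h X Y k x (_ ∷ _)  []       = 1#
  weightOf q qi h X Y k x (r ∷ rs) (d ∷ ds) =
    lozW q qi h X Y k x r d * weightOf q qi h X Y k x rs ds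

  tilingTerm : (q qi h X Y : Carrier) (k : ℤ) (x y : ℕ) → Subset (x ℕ.+ y) → List Dir → Carrier
  tilingTerm q qi h X Y k x y W ch with partners (RTris x y) ch
  ... | nothing = 0#
  ... | just ps = if does (goodPairing? (LTris x y W) ps)
                  then weightOf q qi h X Y k x (RTris x y) ch
                  else 0#

  M : (q qi h X Y : Carrier) (k : ℤ) (x y : ℕ) → Subset (x ℕ.+ y) → Carrier
  M q qi h X Y k x y W =
    sumR (map (tilingTerm q qi h X Y k x y W) (allDirs (len (RTris x y))))

  elems : {n : ℕ} → Subset n → List ℕ
  elems {n} W = map (λ i → suc (toℕ i)) (filter (_∈ˢ? W) (allFin n))

  -- pairs (w₁,w₂) with w₁ before w₂ in the list (so w₁ < w₂ for elems W)
  pairsOf : List ℕ → List (ℕ × ℕ)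
  pairsOf []       = []
  pairsOf (a ∷ as) = map (a ,_) as ++ pairsOf as

  Δ : (q qi h X Y : Carrier) (k : ℤ) (x y : ℕ) → Subset (x ℕ.+ y) → Carrier
  Δ q qi h X Y k x y W =
    prod (map (λ { (w₁ , w₂) →
           hw q qi h X Y ((+ (w₁ ℕ.+ w₂)) ℤ.+ k ℤ.- (+ (x ℕ.+ y ℕ.+ 1)))
           * qint q qi (w₂ ∸ w₁) })
         (pairsOf (elems W)))

  denom : (q qi : Carrier) → ℕ → Carrier
  denom q qi y = prod (map (qfact q qi) (Data.List.drop 1 (upTo y)))
    where import Data.List

{-# OPTIONS --safe #-}
module Submission where

open import Defs
open import Level using (Level; _⊔_)
open import Data.Nat using (ℕ; zero; suc; _<_)
open import Data.Integer using (ℤ)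
open import Data.Sum using (_⊎_; inj₁; inj₂)
open import Data.List using (List)
open import Data.Fin.Subset using (Subset; ∣_∣)
open import Data.Product using (_×_; _,_)
open import Relation.Nullary using (¬_; contradiction)
open import Relation.Binary.PropositionalEquality using (_≡_; _≢_)
open import Algebra.Bundles using (CommutativeRing)

-- Cutting a tiling along the vertical lattice lines turns it into a chain of sets V₀, …, V_y = W, where V_c
-- records the horizontal lozenges crossing line c; consecutive sets interlace and determine the slanted lozenges.
-- With Ψ an antiderivative of the weight A, one has Ψ(m + n) - Ψ(m - n) = A(m) ⟨n⟩, so that Δ is the Vandermonde
-- product in the nodes Ψ(2w + a), a depending on the line. The claim, by induction on y, is that the weighted sum
-- over tilings, multiplied by the q-factorials, is the determinant of the Newton basis at these nodes. In the Newton
-- basis the difference of the (j+1)-st function along line y + 1 is ⟨j+1⟩ times the lozenge weight times the j-th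
-- function on line y, so summing a column by multilinearity produces the differences of consecutive rows
-- of the next determinant.

-- Nothing may be divided: in a commutative ring neither `q - qi` nor a q-integer need be
-- invertible. So `Ψ` is built by recursion instead of by its closed form, and the constants ⟨j+1⟩
-- stay as column factors of the smaller determinant. For y columns they multiply to ⟨y⟩!, the ratio
-- of two consecutive denominators. Powers of the nodes would not serve, since weighted sums of
-- powers mix degrees. The Newton functions whose interpolation points are the nodes 0, 1, ... of
-- the same line are products of weights and q-integers, an analogue of falling factorials, and they
-- are summed by raising the degree by one while lowering `a` by one. Every line needs its own basis
-- for this; that is harmless, because all monic bases have the same determinant, the Vandermonde
-- product. Interlacing is half-open in 0-based positions: between consecutive marks v < v′ of line
-- y + 1 lies one horizontal lozenge of line y, on a segment u with v ≤ u < v′. This is why the sum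
-- over u telescopes to a difference of the rows at v′ and v with no correction at the ends.

module Columns where
  open import Data.Nat as ℕ using (ℕ; zero; suc; pred; _+_; _≤_; _<_; z≤n; s≤s; _≡ᵇ_; _<?_)
  open import Data.Nat.Properties
    using (+-identityʳ; +-suc; +-comm; +-assoc; ≤-refl; ≤-trans; <-irrefl; <⇒≢; m≤m+n; m≤n+m; n≤1+n;
           suc-injective; ≡ᵇ⇒≡; ≡⇒≡ᵇ; +-cancelʳ-≡; m<n⇒m<1+n; m<m+n; ≤∧≢⇒<; pred[n]≤n)
  open import Data.Bool using (Bool; true; false; not; _∧_; if_then_else_; T)
  open import Data.Bool.Properties using (T-≡; not-injective) renaming (_≟_ to _≟ᵇ_)
  open import Data.Fin using (fromℕ<)
  open import Data.Fin.Subset using (Subset; ∣_∣; inside; outside)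
  open import Data.Fin.Subset.Properties using () renaming (_∈?_ to _∈ˢ?_)
  open import Data.Vec using (toList; []; _∷_)
  open import Data.Vec.Properties using (length-toList)
  open import Data.List using
    (List; []; _∷_; map; concat; concatMap; upTo; applyUpTo; _++_; length; take; drop; null; replicate;
     [_]; _∷ʳ_)
  open import Data.List.Properties using (upTo-∷ʳ; map-++; concat-++; ++-identityʳ; length-map)
  open import Data.List.Relation.Unary.All as All using (All; []; _∷_)
  import Data.List.Relation.Unary.All.Properties as AllP
  open import Data.List.Relation.Unary.Any using (here; there)
  open import Data.List.Relation.Unary.AllPairs using ([]; _∷_)
  open import Data.List.Relation.Unary.Unique.Propositional using (Unique)
  open import Data.List.Membership.Propositional using (_∈_; find; lose)
  open import Data.List.Membership.Propositional.Properties using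
    (∈-filter⁺; ∈-filter⁻; ∈-concatMap⁺; ∈-concatMap⁻; ∈-map⁺; ∈-map⁻; ∈-upTo⁺; ∈-upTo⁻)
  open import Data.Maybe using (just; nothing)
  open import Data.Maybe.Properties using (just-injective)
  open import Data.Product using (_×_; _,_; ∃; ∃₂; proj₁; proj₂)
  open import Data.Product.Properties using (≡-dec)
  open import Function using (_∘_; case_of_; Equivalence)
  open import Relation.Nullary using (¬_; Dec; yes; no; does; contradiction)
  open import Relation.Nullary.Decidable using (dec-true; dec-false)
  open import Relation.Binary.PropositionalEquality
    using (_≡_; _≢_; refl; sym; trans; cong; cong₂; subst; module ≡-Reasoning)

  -- Exact covers by counting multiplicities.

  bn : Bool → ℕ
  bn true  = 1
  bn false = 0

  abstract
    hit : Cell → Cell → ℕ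
    hit p l = bn (does (≡-dec ℕ._≟_ ℕ._≟_ p l))

    hit-refl : ∀ p → hit p p ≡ 1
    hit-refl p = cong bn (dec-true (≡-dec ℕ._≟_ ℕ._≟_ p p) refl)

    hit-≢ : ∀ {p l} → p ≢ l → hit p l ≡ 0
    hit-≢ {p} {l} p≢l = cong bn (dec-false (≡-dec ℕ._≟_ ℕ._≟_ p l) p≢l)

  -- Multiplicities turn an exact cover into one equation per cell. Unlike membership and uniqueness
  -- they are additive over `++`, so the equation can be split column by column and cancelled.
  occ : Cell → List Cell → ℕ
  occ l []       = 0
  occ l (p ∷ ps) = hit p l + occ l ps

  occ-++ : ∀ l ps qs → occ l (ps ++ qs) ≡ occ l ps + occ l qs
  occ-++ l []       qs = refl
  occ-++ l (p ∷ ps) qs = trans (cong (hit p l +_) (occ-++ l ps qs)) (sym (+-assoc (hit p l) _ _))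

  occ-none : ∀ {l ps} → All (_≢ l) ps → occ l ps ≡ 0
  occ-none []           = refl
  occ-none (p≢l ∷ rest) = cong₂ _+_ (hit-≢ p≢l) (occ-none rest)

  occ-unique : ∀ {l ps} → Unique ps → l ∈ ps → occ l ps ≡ 1
  occ-unique {l} (p∉ps ∷ _) (here refl) =
    cong₂ _+_ (hit-refl l) (occ-none (All.map (λ ne eq → ne (sym eq)) p∉ps))
  occ-unique (p∉ps ∷ u) (there l∈ps) =
    cong₂ _+_ (hit-≢ (All.lookup p∉ps l∈ps)) (occ-unique u l∈ps)

  occ-∈⁻ : ∀ {l n} ps → occ l ps ≡ suc n → l ∈ ps
  occ-∈⁻ {l} (p ∷ ps) eq with ≡-dec ℕ._≟_ ℕ._≟_ p l
  ... | yes refl = here refl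
  ... | no p≢l   = there (occ-∈⁻ ps (trans (cong (_+ occ l ps) (sym (hit-≢ p≢l))) eq))

  occ-∈⁺ : ∀ {l ps} → l ∈ ps → 1 ≤ occ l ps
  occ-∈⁺ {l} (here refl) rewrite hit-refl l = s≤s z≤n
  occ-∈⁺ {l} {p ∷ ps} (there l∈ps) = ≤-trans (occ-∈⁺ l∈ps) (m≤n+m _ (hit p l))

  occ≤1⇒unique : ∀ ps → (∀ l → occ l ps ≤ 1) → Unique ps
  occ≤1⇒unique []       _  = []
  occ≤1⇒unique (p ∷ ps) le = All.tabulate fresh ∷ occ≤1⇒unique ps tail≤
    where
    fresh : ∀ {l} → l ∈ ps → p ≢ l
    fresh l∈ps refl with le p
    ... | le-p rewrite hit-refl p with occ p ps | occ-∈⁺ l∈ps | le-p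
    ... | suc _ | _ | s≤s ()
    tail≤ : ∀ l → occ l ps ≤ 1
    tail≤ l = ≤-trans (m≤n+m _ (hit p l)) (le l)

  bn≤1 : ∀ b → bn b ≤ 1
  bn≤1 true  = ≤-refl
  bn≤1 false = z≤n

  module _ {Ls : List Cell} (present : Cell → Bool)
           (sound : ∀ {l} → l ∈ Ls → present l ≡ true)
           (complete : ∀ {l} → present l ≡ true → l ∈ Ls) where

    good⇒occ : ∀ {ps} → GoodPairing Ls ps → ∀ l → occ l ps ≡ bn (present l)
    good⇒occ (ps⊆Ls , unique , Ls⊆ps) l with present l in eq
    ... | true  = occ-unique unique (All.lookup Ls⊆ps (complete eq))
    ... | false = occ-none (All.map (λ { p∈Ls refl → case trans (sym eq) (sound p∈Ls) of λ () }) ps⊆Ls)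

    occ⇒good : ∀ {ps} → (∀ l → occ l ps ≡ bn (present l)) → GoodPairing Ls ps
    occ⇒good {ps} count =
        All.tabulate (λ {l} l∈ps → complete (present-∈ l∈ps))
      , occ≤1⇒unique ps (λ l → subst (_≤ 1) (sym (count l)) (bn≤1 (present l)))
      , All.tabulate (λ {l} l∈Ls → occ-∈⁻ ps (trans (count l) (cong bn (sound l∈Ls))))
      where
      present-∈ : ∀ {l} → l ∈ ps → present l ≡ true
      present-∈ {l} l∈ps with present l | count l | occ-∈⁺ l∈ps
      ... | true  | _ | _ = refl
      ... | false | eq | 1≤ = case subst (1 ≤_) eq 1≤ of λ ()

  -- Directions within a single column.

  isHor isDown isUp : Dir → Bool
  isHor hor = true
  isHor _   = false
  isDown down = true
  isDown _    = false
  isUp up = true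
  isUp _  = false

  hors : List Dir → List Bool
  hors = map isHor

  at : List Bool → ℕ → Bool
  at []       _       = false
  at (b ∷ _)  zero    = b
  at (_ ∷ bs) (suc t) = at bs t

  -- Not the negation of `at`: past the end of the list there is no triangle, so both are false
  -- there.
  remaining : List Bool → ℕ → Bool
  remaining []       _       = false
  remaining (b ∷ _)  zero    = not b
  remaining (_ ∷ bs) (suc t) = remaining bs t

  none : List Bool → Bool
  none []       = true
  none (b ∷ bs) = not b ∧ none bs

  ones : List Bool → ℕ
  ones []       = 0
  ones (b ∷ bs) = bn b + ones bs

  -- Reading a column upwards, cov says whether the current left-pointing triangle is already covered by the
  -- lozenge below it, and bs marks the left-pointing triangles that no slanted lozenge may cover.
  accept : Bool → List Bool → List Dir → Bool
  accept cov []       _        = false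
  accept cov (b ∷ bs) []       = null bs ∧ (bn cov ≡ᵇ bn (not b))
  accept cov (b ∷ bs) (d ∷ ds) = (bn cov + bn (isDown d) ≡ᵇ bn (not b)) ∧ accept (isUp d) bs ds

  -- Counts the slanted lozenges of a column that cover the left-pointing triangle at height t: the
  -- right-pointing triangle at the same height going down, or the one below it going up. The flag
  -- carries the second contribution.
  vcount : Bool → List Dir → ℕ → ℕ
  vcount cov []       zero    = bn cov
  vcount cov []       (suc _) = 0
  vcount cov (d ∷ _)  zero    = bn cov + bn (isDown d)
  vcount cov (d ∷ ds) (suc t) = vcount (isUp d) ds t

  ∧-split : ∀ {a b} → a ∧ b ≡ true → a ≡ true × b ≡ true
  ∧-split {true} {true} _ = refl , refl

  ∧-join : ∀ {a b} → a ≡ true → b ≡ true → a ∧ b ≡ true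
  ∧-join refl refl = refl

  ≡ᵇ-sound : ∀ m n → (m ≡ᵇ n) ≡ true → m ≡ n
  ≡ᵇ-sound m n eq = ≡ᵇ⇒≡ m n (subst T (sym eq) _)

  ≡ᵇ-complete : ∀ m n → m ≡ n → (m ≡ᵇ n) ≡ true
  ≡ᵇ-complete m n eq = Equivalence.to T-≡ (≡⇒≡ᵇ m n eq)

  accept⇒length : ∀ cov bs ds → accept cov bs ds ≡ true → length bs ≡ suc (length ds)
  accept⇒length cov (_ ∷ [])     []       _  = refl
  accept⇒length cov (_ ∷ bs)     (d ∷ ds) eq =
    cong suc (accept⇒length (isUp d) bs ds (proj₂ (∧-split eq)))

  accept⇒vcount : ∀ cov bs ds → accept cov bs ds ≡ true → ∀ t → vcount cov ds t ≡ bn (remaining bs t)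
  accept⇒vcount cov (b ∷ []) [] eq zero    = ≡ᵇ-sound (bn cov) _ eq
  accept⇒vcount cov (b ∷ []) [] eq (suc t) = refl
  accept⇒vcount cov (b ∷ bs) (d ∷ ds) eq zero    = ≡ᵇ-sound (bn cov + bn (isDown d)) _ (proj₁ (∧-split eq))
  accept⇒vcount cov (b ∷ bs) (d ∷ ds) eq (suc t) = accept⇒vcount (isUp d) bs ds (proj₂ (∧-split eq)) t

  vcount⇒accept : ∀ cov bs ds → length bs ≡ suc (length ds) →
                  (∀ t → vcount cov ds t ≡ bn (remaining bs t)) → accept cov bs ds ≡ true
  vcount⇒accept cov (b ∷ []) []       _  eq = ≡ᵇ-complete (bn cov) _ (eq 0)
  vcount⇒accept cov (b ∷ bs) (d ∷ ds) le eq =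
    ∧-join (≡ᵇ-complete (bn cov + bn (isDown d)) _ (eq 0))
           (vcount⇒accept (isUp d) bs ds (suc-injective le) (λ t → eq (suc t)))

  -- Slanted lozenges counted in two ways: a column has one more left-pointing than right-pointing
  -- triangle, so the marks exceed the horizontal lozenges by one. `cov` accounts for a lozenge
  -- entering from below.
  accept⇒ones : ∀ cov bs ds → accept cov bs ds ≡ true → ones bs + bn cov ≡ suc (ones (hors ds))
  accept⇒ones false (true ∷ [])  []  _ = refl
  accept⇒ones true  (false ∷ []) []  _ = refl
  accept⇒ones false (false ∷ []) [] ()
  accept⇒ones true  (true ∷ [])  [] ()
  accept⇒ones false (false ∷ bs) (down ∷ ds) eq = accept⇒ones false bs ds eq
  accept⇒ones false (true ∷ bs)  (hor ∷ ds)  eq = cong suc (accept⇒ones false bs ds eq)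
  accept⇒ones false (true ∷ bs)  (up ∷ ds)   eq =
    trans (trans (cong suc (+-identityʳ _)) (+-comm 1 (ones bs))) (accept⇒ones true bs ds eq)
  accept⇒ones true  (false ∷ bs) (hor ∷ ds)  eq =
    trans (trans (+-comm (ones bs) 1) (cong suc (sym (+-identityʳ _)))) (cong suc (accept⇒ones false bs ds eq))
  accept⇒ones true  (false ∷ bs) (up ∷ ds)   eq = accept⇒ones true bs ds eq

  -- Cells covered by the lozenges of one column.

  segs : ℕ → ℕ → ℕ → List Cell
  segs c s zero    = []
  segs c s (suc m) = (c , s) ∷ segs c (suc s) m

  segs-upTo : ∀ c s m (f : ℕ → ℕ) → (∀ i → f i ≡ s + i) → map (c ,_) (applyUpTo f m) ≡ segs c s m
  segs-upTo c s zero    f eq = refl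
  segs-upTo c s (suc m) f eq =
    cong₂ _∷_ (cong (c ,_) (trans (eq 0) (+-identityʳ s)))
              (segs-upTo c (suc s) m (f ∘ suc) (λ i → trans (eq (suc i)) (+-suc s i)))

  length-segs : ∀ c s m → length (segs c s m) ≡ m
  length-segs c s zero    = refl
  length-segs c s (suc m) = cong suc (length-segs c (suc s) m)

  RTris-suc : ∀ x y → RTris x (suc y) ≡ RTris x y ++ segs y 0 (x + y)
  RTris-suc x y = begin
    concatMap col (upTo (suc y))           ≡⟨ cong (concatMap col) (sym (upTo-∷ʳ y)) ⟩
    concatMap col (upTo y ∷ʳ y)            ≡⟨ cong concat (map-++ col (upTo y) [ y ]) ⟩
    concat (map col (upTo y) ++ [ col y ]) ≡⟨ sym (concat-++ (map col (upTo y)) [ col y ]) ⟩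
    RTris x y ++ (col y ++ [])             ≡⟨ cong (RTris x y ++_) (++-identityʳ (col y)) ⟩
    RTris x y ++ col y                     ≡⟨ cong (RTris x y ++_) (segs-upTo y 0 (x + y) (λ i → i) (λ _ → refl)) ⟩
    RTris x y ++ segs y 0 (x + y)          ∎
    where
    open ≡-Reasoning
    col : ℕ → List Cell
    col c = map (c ,_) (upTo (x + c))

  -- In column 0 a horizontal lozenge would stick out of the left side.
  Ok : ℕ → Dir → Set
  Ok c d = d ≡ hor → c ≢ 0

  -- The value of target 0 s hor is junk, since pred 0 = 0; it is excluded by Ok.
  target : ℕ → ℕ → Dir → Cell
  target c s hor  = pred c , s
  target c s down = c , s
  target c s up   = c , suc s

  partner-ok : ∀ c s d → Ok c d → partner (c , s) d ≡ just (target c s d)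
  partner-ok zero    s hor  ok = contradiction refl (ok refl)
  partner-ok (suc c) s hor  _  = refl
  partner-ok zero    s down _  = refl
  partner-ok (suc c) s down _  = refl
  partner-ok zero    s up   _  = refl
  partner-ok (suc c) s up   _  = refl

  partner-just : ∀ c s d {l} → partner (c , s) d ≡ just l → Ok c d
  partner-just zero    s hor  ()
  partner-just (suc c) s hor  _ _ ()
  partner-just c       s down _ ()
  partner-just c       s up   _ ()

  partners-∷⁺ : ∀ {l ls} r rs d ds → partner r d ≡ just l → partners rs ds ≡ just ls →
                partners (r ∷ rs) (d ∷ ds) ≡ just (l ∷ ls)
  partners-∷⁺ r rs d ds e₁ e₂ rewrite e₁ | e₂ = refl

  partners-∷⁻ : ∀ {ps} r rs d ds → partners (r ∷ rs) (d ∷ ds) ≡ just ps →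
                ∃₂ λ l ls → partner r d ≡ just l × partners rs ds ≡ just ls × ps ≡ l ∷ ls
  partners-∷⁻ r rs d ds eq with partner r d | partners rs ds
  partners-∷⁻ r rs d ds refl | just l | just ls = l , ls , refl , refl , refl

  partners-++⁺ : ∀ rs {rs′} ch {ps ps′} → partners rs (take (length rs) ch) ≡ just ps →
                 partners rs′ (drop (length rs) ch) ≡ just ps′ →
                 partners (rs ++ rs′) ch ≡ just (ps ++ ps′)
  partners-++⁺ []       ch       refl e₂ = e₂
  partners-++⁺ (r ∷ rs) {rs′} (d ∷ ch) e₁   e₂ with partners-∷⁻ r rs d (take (length rs) ch) e₁
  ... | _ , _ , h , t , refl = partners-∷⁺ r (rs ++ rs′) d ch h (partners-++⁺ rs ch t e₂)

  partners-++⁻ : ∀ rs {rs′} ch {qs} → partners (rs ++ rs′) ch ≡ just qs →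
                 ∃₂ λ ps ps′ → partners rs (take (length rs) ch) ≡ just ps
                             × partners rs′ (drop (length rs) ch) ≡ just ps′ × qs ≡ ps ++ ps′
  partners-++⁻ []       ch       eq = [] , _ , refl , eq , refl
  partners-++⁻ (r ∷ rs) {rs′} (d ∷ ch) eq with partners-∷⁻ r (rs ++ rs′) d ch eq
  ... | _ , _ , h , t , refl with partners-++⁻ rs ch t
  ... | _ , _ , e₁ , e₂ , refl = _ , _ , partners-∷⁺ r rs d (take (length rs) ch) h e₁ , e₂ , refl

  targets : ℕ → ℕ → List Dir → List Cell
  targets c s []       = []
  targets c s (d ∷ ds) = target c s d ∷ targets c (suc s) ds

  partners-segs⁺ : ∀ c s {ds} → All (Ok c) ds → partners (segs c s (length ds)) ds ≡ just (targets c s ds)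
  partners-segs⁺ c s []         = refl
  partners-segs⁺ c s {d ∷ ds} (ok ∷ oks) =
    partners-∷⁺ (c , s) (segs c (suc s) (length ds)) d ds (partner-ok c s d ok) (partners-segs⁺ c (suc s) oks)

  partners-segs⁻ : ∀ c s m ds {ps} → partners (segs c s m) ds ≡ just ps →
                   length ds ≡ m × All (Ok c) ds × ps ≡ targets c s ds
  partners-segs⁻ c s zero    []       refl = refl , [] , refl
  partners-segs⁻ c s (suc m) (d ∷ ds) eq with partners-∷⁻ (c , s) (segs c (suc s) m) d ds eq
  ... | _ , _ , h , t , refl with partner-just c s d h | partners-segs⁻ c (suc s) m ds t
  ... | ok | refl , oks , refl =
    refl , ok ∷ oks , cong (_∷ _) (just-injective (trans (sym h) (partner-ok c s d ok)))

  target-height : ∀ c s d → s ≤ proj₂ (target c s d)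
  target-height c s hor  = ≤-refl
  target-height c s down = ≤-refl
  target-height c s up   = n≤1+n s

  occ-below : ∀ c s {c′ t} ds → t < s → occ (c′ , t) (targets c s ds) ≡ 0
  occ-below c s []       _   = refl
  occ-below c s {c′} {t} (d ∷ ds) t<s = cong₂ _+_
    (hit-≢ {target c s d} {c′ , t} (λ eq → <-irrefl (sym (cong proj₂ eq)) (≤-trans t<s (target-height c s d))))
    (occ-below c (suc s) ds (m<n⇒m<1+n t<s))

  hit-column : ∀ {c c′ s t} → c ≢ c′ → hit (c , s) (c′ , t) ≡ 0
  hit-column {c} {c′} {s} {t} c≢c′ = hit-≢ {c , s} {c′ , t} (λ eq → c≢c′ (cong proj₁ eq))

  hit-height : ∀ {c c′ s t} → s ≢ t → hit (c , s) (c′ , t) ≡ 0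
  hit-height {c} {c′} {s} {t} s≢t = hit-≢ {c , s} {c′ , t} (λ eq → s≢t (cong proj₂ eq))

  pred-≢ : ∀ {c} → c ≢ 0 → pred c ≢ c
  pred-≢ {zero} c≢0 = c≢0
  pred-≢ {suc c} _ eq = <-irrefl eq ≤-refl

  hit-down : ∀ {c} s d → Ok c d → hit (target c s d) (c , s) ≡ bn (isDown d)
  hit-down s hor  ok = hit-column (pred-≢ (ok refl))
  hit-down {c} s down _  = hit-refl (c , s)
  hit-down s up   _  = hit-height (λ eq → <-irrefl (sym eq) ≤-refl)

  hit-up : ∀ {c} s d → Ok c d → hit (target c s d) (c , suc s) ≡ bn (isUp d)
  hit-up s hor  ok = hit-column (pred-≢ (ok refl))
  hit-up s down _  = hit-height (λ eq → <-irrefl eq ≤-refl)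
  hit-up {c} s up   _  = hit-refl (c , suc s)

  hit-high : ∀ {c} s t d → Ok c d → hit (target c s d) (c , suc s + suc t) ≡ 0
  hit-high s t hor  ok = hit-column (pred-≢ (ok refl))
  hit-high s t down _  = hit-height (λ eq → <-irrefl eq (s≤s (m≤m+n s (suc t))))
  hit-high s t up   _  = hit-height (λ eq → <-irrefl eq (s≤s (m<m+n s (s≤s z≤n))))

  occ-targets₀ : ∀ {c} s cov {ds} → All (Ok c) ds →
                 bn cov + occ (c , s) (targets c s ds) ≡ vcount cov ds 0
  occ-targets₀ s cov [] = +-identityʳ _
  occ-targets₀ {c} s cov {d ∷ ds} (ok ∷ _) = cong (bn cov +_)
    (trans (cong₂ _+_ (hit-down s d ok) (occ-below c (suc s) ds ≤-refl)) (+-identityʳ _))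

  -- `cov` is arbitrary because it only concerns height `s`; above that height every covering
  -- lozenge belongs to `ds`.
  occ-targets₊ : ∀ {c} s cov t {ds} → All (Ok c) ds →
                 occ (c , s + suc t) (targets c s ds) ≡ vcount cov ds (suc t)
  occ-targets₊ s cov t [] = refl
  occ-targets₊ {c} s cov zero {d ∷ ds} (ok ∷ oks) rewrite +-comm s 1 =
    trans (cong (_+ _) (hit-up s d ok)) (occ-targets₀ (suc s) (isUp d) oks)
  occ-targets₊ {c} s cov (suc t) {d ∷ ds} (ok ∷ oks) rewrite +-suc s (suc t) =
    trans (cong (_+ _) (hit-high s t d ok)) (occ-targets₊ (suc s) (isUp d) t oks)

  occ-targets : ∀ {c} {ds} → All (Ok c) ds → ∀ t → occ (c , t) (targets c 0 ds) ≡ vcount false ds t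
  occ-targets oks zero    = occ-targets₀ 0 false oks
  occ-targets oks (suc t) = occ-targets₊ 0 false t oks

  occ-hors : ∀ c s t ds → occ (c , s + t) (targets (suc c) s ds) ≡ bn (at (hors ds) t)
  occ-hors c s t [] = refl
  occ-hors c s zero (d ∷ ds) rewrite +-identityʳ s =
    trans (cong₂ _+_ (lemma d) (occ-below (suc c) (suc s) ds ≤-refl)) (+-identityʳ _)
    where
    lemma : ∀ d → hit (target (suc c) s d) (c , s) ≡ bn (isHor d)
    lemma hor  = hit-refl (c , s)
    lemma down = hit-column (λ eq → <-irrefl (sym eq) ≤-refl)
    lemma up   = hit-column (λ eq → <-irrefl (sym eq) ≤-refl)
  occ-hors c s (suc t) (d ∷ ds) rewrite +-suc s t =
    cong₂ _+_ (lemma d) (occ-hors c (suc s) t ds)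
    where
    lemma : ∀ d → hit (target (suc c) s d) (c , suc (s + t)) ≡ 0
    lemma hor  = hit-height (λ eq → <-irrefl eq (s≤s (m≤m+n s t)))
    lemma down = hit-column (λ eq → <-irrefl (sym eq) ≤-refl)
    lemma up   = hit-column (λ eq → <-irrefl (sym eq) ≤-refl)

  occ-elsewhere : ∀ c s {c′ t} ds → c ≢ c′ → pred c ≢ c′ → occ (c′ , t) (targets c s ds) ≡ 0
  occ-elsewhere c s []       _   _   = refl
  occ-elsewhere c s {c′} {t} (d ∷ ds) ne₁ ne₂ = cong₂ _+_ (lemma d) (occ-elsewhere c (suc s) ds ne₁ ne₂)
    where
    lemma : ∀ d → hit (target c s d) (c′ , t) ≡ 0
    lemma hor  = hit-column ne₂
    lemma down = hit-column ne₁
    lemma up   = hit-column ne₁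

  partners-columns : ∀ {n} rs ds {ps} → All (λ r → proj₁ r < n) rs →
                     partners rs ds ≡ just ps → All (λ p → proj₁ p < n) ps
  partners-columns []       []       _          refl = []
  partners-columns ((c , s) ∷ rs) (d ∷ ds) (lt ∷ lts) eq with partners-∷⁻ (c , s) rs d ds eq
  ... | l , ls , h , t , refl = subst (λ p → proj₁ p < _) target≡ (≤-trans (s≤s (lemma d)) lt)
                                ∷ partners-columns rs ds lts t
    where
    lemma : ∀ d → proj₁ (target c s d) ≤ c
    lemma hor  = pred[n]≤n
    lemma down = ≤-refl
    lemma up   = ≤-refl
    target≡ : target c s d ≡ l
    target≡ = just-injective (trans (sym (partner-ok c s d (partner-just c s d h))) h)

  segs-columns : ∀ c s m → All (λ r → proj₁ r < suc c) (segs c s m)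
  segs-columns c s zero    = []
  segs-columns c s (suc m) = ≤-refl ∷ segs-columns c (suc s) m

  RTris-columns : ∀ x y → All (λ r → proj₁ r < y) (RTris x y)
  RTris-columns x zero    = []
  RTris-columns x (suc y) = subst (All _) (sym (RTris-suc x y))
    (AllP.++⁺ (All.map m<n⇒m<1+n (RTris-columns x y)) (segs-columns y 0 (x + y)))

  -- Cutting off the last column.

  occ-beyond : ∀ x y ch {ps c t} → partners (RTris x y) ch ≡ just ps → y ≤ c → occ (c , t) ps ≡ 0
  occ-beyond x y ch eq y≤c =
    occ-none (All.map (λ { p<y refl → <-irrefl refl (≤-trans p<y y≤c) })
                      (partners-columns (RTris x y) ch (RTris-columns x y) eq))

  -- Triangles are deleted only along the right side, so all earlier columns are those of the
  -- trapezoid with no marks.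
  present : ℕ → ℕ → List Bool → Cell → Bool
  present x zero    w (c , t) = false
  present x (suc y) w (c , t) =
    if does (c ℕ.≟ y) then remaining w t else present x y (replicate (x + y) false) (c , t)

  Tiled : ℕ → ℕ → List Bool → List Dir → Set
  Tiled x y w ch = ∃ λ ps → partners (RTris x y) ch ≡ just ps × (∀ l → occ l ps ≡ bn (present x y w l))

  -- The last x + y directions describe the column between lines y and y + 1.
  tiled : ℕ → ℕ → List Bool → List Dir → Bool
  tiled x zero    w ch = null ch ∧ none w
  tiled x (suc y) w ch =
    accept false w (drop (length (RTris x y)) ch)
      ∧ tiled x y (hors (drop (length (RTris x y)) ch)) (take (length (RTris x y)) ch)

  ok-none⁺ : ∀ {ds} → All (Ok 0) ds → none (hors ds) ≡ true
  ok-none⁺ [] = refl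
  ok-none⁺ {hor ∷ _}  (ok ∷ _)  = contradiction refl (ok refl)
  ok-none⁺ {down ∷ _} (_ ∷ oks) = ok-none⁺ oks
  ok-none⁺ {up ∷ _}   (_ ∷ oks) = ok-none⁺ oks

  ok-none⁻ : ∀ ds → none (hors ds) ≡ true → All (Ok 0) ds
  ok-none⁻ []          _  = []
  ok-none⁻ (down ∷ ds) eq = (λ ()) ∷ ok-none⁻ ds eq
  ok-none⁻ (up ∷ ds)   eq = (λ ()) ∷ ok-none⁻ ds eq

  remaining-full : ∀ w t → bn (remaining (replicate (length w) false) t) ≡ bn (remaining w t) + bn (at w t)
  remaining-full []          t       = refl
  remaining-full (true ∷ w)  zero    = refl
  remaining-full (false ∷ w) zero    = refl
  remaining-full (_ ∷ w)     (suc t) = remaining-full w t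

  present-last : ∀ x y w t → present x (suc y) w (y , t) ≡ remaining w t
  present-last x y w t rewrite dec-true (y ℕ.≟ y) refl = refl

  present-earlier : ∀ x y w {c} t → c ≢ y →
                    present x (suc y) w (c , t) ≡ present x y (replicate (x + y) false) (c , t)
  present-earlier x y w {c} t c≢y rewrite dec-false (c ℕ.≟ y) c≢y = refl

  present-beyond : ∀ x y w {c} t → y ≤ c → present x y w (c , t) ≡ false
  present-beyond x zero    w t _   = refl
  present-beyond x (suc y) w t y<c =
    trans (present-earlier x y w t (<⇒≢ y<c ∘ sym))
          (present-beyond x y _ t (≤-trans (n≤1+n y) y<c))

  -- The reason the cut works: the triangles of column `y` taken by horizontal lozenges across line
  -- `suc y` are exactly the ones deleted from the smaller trapezoid with marks `hors ds`. Other
  -- earlier columns are untouched by `ds`.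
  present-split : ∀ x y ds → length ds ≡ x + suc y → ∀ {c} t → c ≢ suc y →
    bn (present x (suc y) (replicate (x + suc y) false) (c , t))
      ≡ bn (present x (suc y) (hors ds) (c , t)) + occ (c , t) (targets (suc y) 0 ds)
  present-split x y ds le {c} t c≢ = by-column (c ℕ.≟ y)
    where
    full = replicate (x + suc y) false
    by-column : Dec (c ≡ y) → bn (present x (suc y) full (c , t))
                  ≡ bn (present x (suc y) (hors ds) (c , t)) + occ (c , t) (targets (suc y) 0 ds)
    by-column (yes refl)
      rewrite present-last x y full t | present-last x y (hors ds) t | occ-hors y 0 t ds
            | sym le | sym (length-map isHor ds) = remaining-full (hors ds) t
    by-column (no c≢y)
      rewrite present-earlier x y full t c≢y | present-earlier x y (hors ds) t c≢y
            | occ-elsewhere (suc y) 0 {c} {t} ds (c≢ ∘ sym) (c≢y ∘ sym) = sym (+-identityʳ _)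

  partners-RTris⁻ : ∀ x y ch {ps} → partners (RTris x (suc y)) ch ≡ just ps →
    let N = length (RTris x y) in
    ∃ λ ps₁ → partners (RTris x y) (take N ch) ≡ just ps₁ × length (drop N ch) ≡ x + y
            × All (Ok y) (drop N ch) × ps ≡ ps₁ ++ targets y 0 (drop N ch)
  partners-RTris⁻ x y ch eq
    with partners-++⁻ (RTris x y) ch (subst (λ rs → partners rs ch ≡ _) (RTris-suc x y) eq)
  ... | ps₁ , _ , e₁ , e₂ , refl with partners-segs⁻ y 0 (x + y) (drop (length (RTris x y)) ch) e₂
  ... | le , oks , refl = ps₁ , e₁ , le , oks , refl

  partners-RTris⁺ : ∀ x y ch {ps₁} →
    let N = length (RTris x y) in
    partners (RTris x y) (take N ch) ≡ just ps₁ → length (drop N ch) ≡ x + y → All (Ok y) (drop N ch) →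
    partners (RTris x (suc y)) ch ≡ just (ps₁ ++ targets y 0 (drop N ch))
  partners-RTris⁺ x y ch e₁ le oks rewrite RTris-suc x y =
    partners-++⁺ (RTris x y) ch e₁
      (subst (λ m → partners (segs y 0 m) ds ≡ just (targets y 0 ds)) le (partners-segs⁺ y 0 oks))
    where ds = drop (length (RTris x y)) ch

  Tiled⇒tiled : ∀ x y w ch → length w ≡ x + suc y → Tiled x (suc y) w ch → tiled x (suc y) w ch ≡ true
  Tiled⇒tiled x y w ch lw (_ , eq , count) with partners-RTris⁻ x y ch eq
  ... | ps₁ , e₁ , ld , oks , refl = ∧-join accepted (earlier y refl)
    where
    open ≡-Reasoning
    ds = drop (length (RTris x y)) ch
    count-++ : ∀ l → occ l ps₁ + occ l (targets y 0 ds) ≡ bn (present x (suc y) w l)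
    count-++ l = trans (sym (occ-++ l ps₁ _)) (count l)
    accepted : accept false w ds ≡ true
    accepted = vcount⇒accept false w ds (trans lw (trans (+-suc x y) (cong suc (sym ld)))) λ t → begin
      vcount false ds t                              ≡⟨ sym (occ-targets oks t) ⟩
      occ (y , t) (targets y 0 ds)
        ≡⟨ cong (_+ occ (y , t) (targets y 0 ds)) (sym (occ-beyond x y _ e₁ ≤-refl)) ⟩
      occ (y , t) ps₁ + occ (y , t) (targets y 0 ds) ≡⟨ count-++ (y , t) ⟩
      bn (present x (suc y) w (y , t))               ≡⟨ cong bn (present-last x y w t) ⟩
      bn (remaining w t)                             ∎
    -- Both cases share the decomposition above. With no earlier column, what is left to show is
    -- that no lozenge of column 0 is horizontal; otherwise the share of the last column is
    -- cancelled from the counts.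
    earlier : ∀ y′ → y ≡ y′ → tiled x y (hors ds) (take (length (RTris x y)) ch) ≡ true
    earlier zero    refl = ok-none⁺ oks
    earlier (suc y′) refl =
      Tiled⇒tiled x y′ (hors ds) _ (trans (length-map isHor ds) ld) (ps₁ , e₁ , count₁)
      where
      count₁ : ∀ l → occ l ps₁ ≡ bn (present x (suc y′) (hors ds) l)
      count₁ (c , t) with c ℕ.≟ suc y′
      ... | yes refl = trans (occ-beyond x y _ e₁ ≤-refl) (sym (cong bn (present-beyond x y (hors ds) t ≤-refl)))
      ... | no c≢ = +-cancelʳ-≡ (occ (c , t) (targets y 0 ds)) _ _ (begin
        occ (c , t) ps₁ + occ (c , t) (targets y 0 ds)                 ≡⟨ count-++ (c , t) ⟩
        bn (present x (suc y) w (c , t))                               ≡⟨ cong bn (present-earlier x y w t c≢) ⟩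
        bn (present x y (replicate (x + y) false) (c , t))             ≡⟨ present-split x y′ ds ld t c≢ ⟩
        bn (present x y (hors ds) (c , t)) + occ (c , t) (targets y 0 ds) ∎)

  tiled⇒Tiled : ∀ x y w ch → length w ≡ x + suc y → tiled x (suc y) w ch ≡ true → Tiled x (suc y) w ch
  tiled⇒Tiled x y w ch lw eq =
    _ , partners-RTris⁺ x y ch (proj₁ (proj₂ init)) ld (ok y refl) , λ l → trans (occ-++ l ps₁ _) (count l)
    where
    open ≡-Reasoning
    N  = length (RTris x y)
    ds = drop N ch
    accepted : accept false w ds ≡ true
    accepted = proj₁ (∧-split eq)
    rest : tiled x y (hors ds) (take N ch) ≡ true
    rest = proj₂ (∧-split {accept false w ds} eq)
    ld : length ds ≡ x + y
    ld = suc-injective (trans (sym (accept⇒length false w ds accepted)) (trans lw (+-suc x y)))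
    ok : ∀ y′ → y ≡ y′ → All (Ok y) ds
    ok zero     refl = ok-none⁻ ds (proj₂ (∧-split {null (take N ch)} rest))
    ok (suc y′) refl = All.tabulate λ _ _ ()
    earlier : ∀ y′ → y ≡ y′ →
              ∃ λ ps₁ → partners (RTris x y) (take N ch) ≡ just ps₁ ×
                        (∀ c t → c ≢ y → occ (c , t) ps₁ + occ (c , t) (targets y 0 ds)
                                           ≡ bn (present x y (replicate (x + y) false) (c , t)))
    earlier zero     refl = [] , refl , λ c t c≢0 → occ-elsewhere 0 0 ds (c≢0 ∘ sym) (c≢0 ∘ sym)
    earlier (suc y′) refl with tiled⇒Tiled x y′ (hors ds) (take N ch) (trans (length-map isHor ds) ld) rest
    ... | ps₁ , e₁ , count₁ = ps₁ , e₁ , λ c t c≢ →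
      trans (cong (_+ occ (c , t) (targets y 0 ds)) (count₁ (c , t))) (sym (present-split x y′ ds ld t c≢))
    init = earlier y refl
    ps₁ = proj₁ init
    count : ∀ l → occ l ps₁ + occ l (targets y 0 ds) ≡ bn (present x (suc y) w l)
    count (c , t) with c ℕ.≟ y
    ... | no c≢y  = trans (proj₂ (proj₂ init) c t c≢y) (cong bn (sym (present-earlier x y w t c≢y)))
    ... | yes refl = begin
      occ (y , t) ps₁ + occ (y , t) (targets y 0 ds)
        ≡⟨ cong₂ _+_ (occ-beyond x y _ (proj₁ (proj₂ init)) ≤-refl) (occ-targets (ok y refl) t) ⟩
      vcount false ds t                              ≡⟨ accept⇒vcount false w ds accepted t ⟩
      bn (remaining w t)                             ≡⟨ cong bn (sym (present-last x y w t)) ⟩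
      bn (present x (suc y) w (y , t))               ∎

  -- Each column that is cut off uses up exactly one mark, and none is left on the left side.
  tiled⇒ones : ∀ x y w ch → tiled x y w ch ≡ true → ones w ≡ y
  tiled⇒ones x zero    w ch eq = none⇒ones w (proj₂ (∧-split {null ch} eq))
    where
    none⇒ones : ∀ w → none w ≡ true → ones w ≡ 0
    none⇒ones []          _  = refl
    none⇒ones (false ∷ w) eq = none⇒ones w eq
  tiled⇒ones x (suc y) w ch eq =
    trans (trans (sym (+-identityʳ _)) (accept⇒ones false w ds (proj₁ (∧-split eq))))
          (cong suc (tiled⇒ones x y (hors ds) _ (proj₂ (∧-split {accept false w ds} eq))))
    where ds = drop (length (RTris x y)) ch

  -- Agreement of the mark lists with the subsets and triangles of the definition.

  ones-toList : ∀ {n} (W : Subset n) → ones (toList W) ≡ ∣ W ∣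
  ones-toList []            = refl
  ones-toList (inside ∷ W)  = cong suc (ones-toList W)
  ones-toList (outside ∷ W) = ones-toList W

  remaining-toList : ∀ {n} (W : Subset n) {t} (t<n : t < n) →
                     remaining (toList W) t ≡ not (does (fromℕ< t<n ∈ˢ? W))
  remaining-toList (inside ∷ W)  {zero}  _       = refl
  remaining-toList (outside ∷ W) {zero}  _       = refl
  remaining-toList (_ ∷ W)       {suc t} (s≤s p) = remaining-toList W p

  remaining-beyond : ∀ {n} (W : Subset n) {t} → ¬ t < n → remaining (toList W) t ≡ false
  remaining-beyond []      _   = refl
  remaining-beyond (_ ∷ W) {zero}  t≮n = contradiction (s≤s z≤n) t≮n
  remaining-beyond (_ ∷ W) {suc t} t≮n = remaining-beyond W (t≮n ∘ s≤s)

  remaining-replicate : ∀ n {t} → remaining (replicate n false) t ≡ true → t < n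
  remaining-replicate (suc n) {zero}  _  = s≤s z≤n
  remaining-replicate (suc n) {suc t} eq = s≤s (remaining-replicate n eq)

  replicate-remaining : ∀ {n t} → t < n → remaining (replicate n false) t ≡ true
  replicate-remaining {suc n} {zero}  _       = refl
  replicate-remaining {suc n} {suc t} (s≤s p) = replicate-remaining p

  present-full⁺ : ∀ x y {c t} → c < y → t < suc (x + c) → present x y (replicate (x + y) false) (c , t) ≡ true
  present-full⁺ x (suc y) {c} {t} (s≤s c≤y) t< with c ℕ.≟ y
  ... | yes refl = trans
    (present-last x y (replicate (x + suc y) false) t) (replicate-remaining (subst (t <_) (sym (+-suc x y)) t<))
  ... | no c≢y   = trans
    (present-earlier x y (replicate (x + suc y) false) t c≢y) (present-full⁺ x y (≤∧≢⇒< c≤y c≢y) t<)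

  present-full⁻ : ∀ x y {c t} → present x y (replicate (x + y) false) (c , t) ≡ true → c < y × t < suc (x + c)
  present-full⁻ x (suc y) {c} {t} eq with c ℕ.≟ y
  ... | yes refl = ≤-refl , subst (t <_) (+-suc x y)
    (remaining-replicate (x + suc y) (trans (sym (present-last x y (replicate (x + suc y) false) t)) eq))
  ... | no c≢y   =
    let c<y , t< = present-full⁻ x y (trans (sym (present-earlier x y (replicate (x + suc y) false) t c≢y)) eq)
    in m<n⇒m<1+n c<y , t<

  deleted-last : ∀ x y (W : Subset (x + suc y)) {t} → t < suc (x + y) →
                 not (deleted x (suc y) W (y , t)) ≡ remaining (toList W) t
  deleted-last x y W {t} t< rewrite ≡ᵇ-complete y y refl with t <? (x + suc y)
  ... | yes p = sym (remaining-toList W p)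
  ... | no ¬p = contradiction (subst (t <_) (sym (+-suc x y)) t<) ¬p

  deleted-earlier : ∀ x y (W : Subset (x + suc y)) {c t} → c ≢ y → deleted x (suc y) W (c , t) ≡ false
  deleted-earlier x y W {c} {t} c≢y with c ≡ᵇ y in eq | t <? (x + suc y)
  ... | true  | _ = contradiction (≡ᵇ-sound c y eq) c≢y
  ... | false | _ = refl

  LTrisAll-∈⁻ : ∀ x y {c t} → (c , t) ∈ LTrisAll x y → c < y × t < suc (x + c)
  LTrisAll-∈⁻ x y l∈ with find (∈-concatMap⁻ (λ c → map (c ,_) (upTo (suc (x + c)))) {xs = upTo y} l∈)
  ... | c , c∈ , l∈c with ∈-map⁻ (c ,_) l∈c
  ... | t , t∈ , refl = ∈-upTo⁻ c∈ , ∈-upTo⁻ t∈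

  LTrisAll-∈⁺ : ∀ x y {c t} → c < y → t < suc (x + c) → (c , t) ∈ LTrisAll x y
  LTrisAll-∈⁺ x y {c} c<y t< = ∈-concatMap⁺ (λ c → map (c ,_) (upTo (suc (x + c)))) {xs = upTo y}
    (lose (∈-upTo⁺ c<y) (∈-map⁺ (c ,_) (∈-upTo⁺ t<)))

  module _ (x y : ℕ) (W : Subset (x + suc y)) where

    private kept? = λ l → deleted x (suc y) W l ≟ᵇ false

    LTris⇒present : ∀ {l} → l ∈ LTris x (suc y) W → present x (suc y) (toList W) l ≡ true
    LTris⇒present {c , t} l∈ with ∈-filter⁻ kept? {xs = LTrisAll x (suc y)} l∈
    ... | l∈all , kept with LTrisAll-∈⁻ x (suc y) l∈all
    ... | s≤s c≤y , t< with c ℕ.≟ y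
    ... | yes refl = trans (present-last x y (toList W) t) (trans (sym (deleted-last x y W t<)) (cong not kept))
    ... | no c≢y   = trans (present-earlier x y (toList W) t c≢y) (present-full⁺ x y (≤∧≢⇒< c≤y c≢y) t<)

    present⇒LTris : ∀ {l} → present x (suc y) (toList W) l ≡ true → l ∈ LTris x (suc y) W
    present⇒LTris {c , t} eq with c ℕ.≟ y
    ... | no c≢y = let c<y , t< = present-full⁻ x y (trans (sym (present-earlier x y (toList W) t c≢y)) eq) in
      ∈-filter⁺ kept? (LTrisAll-∈⁺ x (suc y) (m<n⇒m<1+n c<y) t<) (deleted-earlier x y W c≢y)
    ... | yes refl with t <? (x + suc y)
    ...   | no ¬p = case trans (sym (remaining-beyond W ¬p)) (trans (sym (present-last x y (toList W) t)) eq) of λ ()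
    ...   | yes p = ∈-filter⁺ kept? (LTrisAll-∈⁺ x (suc y) ≤-refl t<)
                      (not-injective (trans (deleted-last x y W t<) (trans (sym (present-last x y (toList W) t)) eq)))
      where t< = subst (t <_) (+-suc x y) p

    good⇔tiled : ∀ ch {ps} → partners (RTris x (suc y)) ch ≡ just ps →
      (GoodPairing (LTris x (suc y) W) ps → tiled x (suc y) (toList W) ch ≡ true) ×
      (tiled x (suc y) (toList W) ch ≡ true → GoodPairing (LTris x (suc y) W) ps)
    good⇔tiled ch {ps} eq = to , from
      where
      to : GoodPairing (LTris x (suc y) W) ps → tiled x (suc y) (toList W) ch ≡ true
      to good = Tiled⇒tiled x y (toList W) ch (length-toList W)
        (ps , eq , good⇒occ (present x (suc y) (toList W)) LTris⇒present present⇒LTris good)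
      from : tiled x (suc y) (toList W) ch ≡ true → GoodPairing (LTris x (suc y) W) ps
      from t with tiled⇒Tiled x y (toList W) ch (length-toList W) t
      ... | ps′ , eq′ , count with trans (sym eq′) eq
      ... | refl = occ⇒good (present x (suc y) (toList W)) LTris⇒present present⇒LTris count

    IsTiling⇒∣W∣ : ∀ ch → IsTiling x (suc y) W ch → ∣ W ∣ ≡ suc y
    IsTiling⇒∣W∣ ch (ps , eq , good) =
      trans (sym (ones-toList W)) (tiled⇒ones x (suc y) (toList W) ch (proj₁ (good⇔tiled ch eq) good))

-- A ring solver with integer coefficients, through the canonical homomorphism from the integers.

module IntegerSolver {c ℓ : Level} (R : CommutativeRing c ℓ) where
  open CommutativeRing R
  open import Data.Nat as ℕ using (ℕ; zero; suc)
  open import Data.Integer as ℤ using (ℤ; +_; -[1+_]; _⊖_; _◃_)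
  import Data.Integer.Properties as ℤP
  import Data.Sign as Sign
  open import Data.Maybe using (Maybe; just; nothing)
  open import Relation.Nullary using (yes; no)
  import Relation.Binary.PropositionalEquality as ≡
  open import Algebra.Properties.Ring ring
  open import Algebra.Properties.Semiring.Mult.TCOptimised semiring using
    (1+×; ×-homo-+; ×1-homo-*) renaming (_×_ to _·_)
  open import Algebra.Solver.Ring.AlmostCommutativeRing
  open import Relation.Binary.Reasoning.Setoid setoid

  fromℤ : ℤ → Carrier
  fromℤ (+ n)    = n · 1#
  fromℤ -[1+ n ] = - (suc n · 1#)

  fromℤ-neg : ∀ n → fromℤ (ℤ.- (+ n)) ≈ - (n · 1#)
  fromℤ-neg zero    = sym -0#≈0#
  fromℤ-neg (suc n) = refl

  fromℤ-⊖ : ∀ m n → fromℤ (m ⊖ n) ≈ m · 1# - n · 1#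
  fromℤ-⊖ m       zero    = sym (trans (+-congˡ -0#≈0#) (+-identityʳ _))
  fromℤ-⊖ zero    (suc n) = sym (+-identityˡ _)
  fromℤ-⊖ (suc m) (suc n) rewrite ℤP.[1+m]⊖[1+n]≡m⊖n m n = begin
    fromℤ (m ⊖ n)                        ≈⟨ fromℤ-⊖ m n ⟩
    m · 1# - n · 1#                      ≈⟨ +-congʳ (sym (+-identityˡ _)) ⟩
    (0# + m · 1#) - n · 1#               ≈⟨ +-congʳ (+-congʳ (sym (-‿inverseʳ 1#))) ⟩
    ((1# - 1#) + m · 1#) - n · 1#
      ≈⟨ +-congʳ (trans (+-assoc _ _ _) (trans (+-congˡ (+-comm _ _)) (sym (+-assoc _ _ _)))) ⟩
    ((1# + m · 1#) - 1#) - n · 1#        ≈⟨ +-assoc _ _ _ ⟩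
    (1# + m · 1#) + (- 1# - n · 1#)      ≈⟨ +-congˡ (-‿+-comm _ _) ⟩
    (1# + m · 1#) - (1# + n · 1#)        ≈⟨ +-cong (1+× m 1#) (-‿cong (1+× n 1#)) ⟨
    suc m · 1# - suc n · 1#              ∎

  fromℤ-+ : ∀ i j → fromℤ (i ℤ.+ j) ≈ fromℤ i + fromℤ j
  fromℤ-+ (+ m)    (+ n)    = ×-homo-+ 1# m n
  fromℤ-+ (+ m)    -[1+ n ] = fromℤ-⊖ m (suc n)
  fromℤ-+ -[1+ m ] (+ n)    = trans (fromℤ-⊖ n (suc m)) (+-comm _ _)
  fromℤ-+ -[1+ m ] -[1+ n ] = begin
    - (suc (suc (m ℕ.+ n)) · 1#)      ≈⟨ -‿cong (reflexive (≡.cong (λ k → suc k · 1#) (≡.sym (+-suc m n)))) ⟩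
    - ((suc m ℕ.+ suc n) · 1#)        ≈⟨ -‿cong (×-homo-+ 1# (suc m) (suc n)) ⟩
    - (suc m · 1# + suc n · 1#)       ≈⟨ -‿+-comm _ _ ⟨
    - (suc m · 1#) - suc n · 1#       ∎
    where open import Data.Nat.Properties using (+-suc)

  fromℤ-- : ∀ i → fromℤ (ℤ.- i) ≈ - fromℤ i
  fromℤ-- (+ n)    = fromℤ-neg n
  fromℤ-- -[1+ n ] = sym (-‿involutive _)

  fromℤ-◃ : ∀ n → fromℤ (Sign.- ◃ n) ≈ - (n · 1#)
  fromℤ-◃ zero    = sym -0#≈0#
  fromℤ-◃ (suc n) = refl

  fromℤ-* : ∀ i j → fromℤ (i ℤ.* j) ≈ fromℤ i * fromℤ j
  fromℤ-* (+ m)    (+ n)    =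
    trans (reflexive (≡.cong fromℤ (ℤP.+◃n≡+n (m ℕ.* n)))) (×1-homo-* m n)
  fromℤ-* (+ m)    -[1+ n ] = trans (fromℤ-◃ (m ℕ.* suc n))
    (trans (-‿cong (×1-homo-* m (suc n))) (-‿distribʳ-* _ _))
  fromℤ-* -[1+ m ] (+ n)    = trans (fromℤ-◃ (suc m ℕ.* n))
    (trans (-‿cong (×1-homo-* (suc m) n)) (-‿distribˡ-* _ _))
  fromℤ-* -[1+ m ] -[1+ n ] = begin
    (suc m ℕ.* suc n) · 1#            ≈⟨ ×1-homo-* (suc m) (suc n) ⟩
    suc m · 1# * (suc n · 1#)         ≈⟨ -‿involutive _ ⟨
    - - (suc m · 1# * (suc n · 1#))   ≈⟨ -‿cong (-‿distribʳ-* _ _) ⟩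
    - (suc m · 1# * - (suc n · 1#))   ≈⟨ -‿distribˡ-* _ _ ⟩
    - (suc m · 1#) * - (suc n · 1#)   ∎

  fromℤ-morphism : ℤ.+-*-rawRing -Raw-AlmostCommutative⟶ fromCommutativeRing R
  fromℤ-morphism = record
    { ⟦_⟧    = fromℤ
    ; +-homo = fromℤ-+
    ; *-homo = fromℤ-*
    ; -‿homo = fromℤ--
    ; 0-homo = refl
    ; 1-homo = refl
    }

  -- Equality in `R` need not be decidable, so coefficients are compared as integers; `nothing`
  -- claims no inequality in `R`.
  fromℤ-≟ : ∀ i j → Maybe (fromℤ i ≈ fromℤ j)
  fromℤ-≟ i j with i ℤ.≟ j
  ... | yes ≡.refl = just refl
  ... | no _       = nothing

  open import Algebra.Solver.Ring ℤ.+-*-rawRing (fromCommutativeRing R) fromℤ-morphism fromℤ-≟ public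
    using (solve; _:=_; _:+_; _:*_; _:-_; :-_; con)

-- Determinants as multilinear alternating functions of lists of rows.

module Determinants {c ℓ : Level} (R : CommutativeRing c ℓ) where
  open CommutativeRing R
  open IntegerSolver R using (solve; _:=_; _:+_; _:*_; _:-_; :-_; con)
  open import Data.Nat as ℕ using (ℕ; zero; suc)
  open import Data.Integer using (+_)
  open import Data.List using (List; []; _∷_; _++_; map; length)
  open import Data.List.Relation.Unary.All using (All; []; _∷_)
  open import Data.List.Relation.Binary.Pointwise using (Pointwise; []; _∷_)
  open import Function using (_∘_)
  open import Algebra.Properties.Ring ring
  open import Relation.Binary.Reasoning.Setoid setoid

  -- Rows are infinite and a determinant reads a window of columns. Dropping the first column is
  -- then composition with `suc`, and one basis serves all sizes.
  Row : Set c
  Row = ℕ → Carrier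

  infix 4 _≋_
  _≋_ : Row → Row → Set ℓ
  r ≋ s = ∀ j → r j ≈ s j

  _⊕_ _⊝_ : Row → Row → Row
  (r ⊕ s) j = r j + s j
  (r ⊝ s) j = r j - s j

  _⊙_ : Carrier → Row → Row
  (a ⊙ r) j = a * r j

  record Multilinear (F : List Row → Carrier) : Set (c ⊔ ℓ) where
    field
      row-cong : ∀ pre {r s} post → r ≋ s → F (pre ++ r ∷ post) ≈ F (pre ++ s ∷ post)
      linear   : ∀ pre a r s post →
                 F (pre ++ ((a ⊙ r) ⊕ s) ∷ post) ≈ a * F (pre ++ r ∷ post) + F (pre ++ s ∷ post)

  Alternating : (List Row → Carrier) → Set (c ⊔ ℓ)
  Alternating F = ∀ pre r post → F (pre ++ r ∷ r ∷ post) ≈ 0#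

  -- This is what makes induction over the list of rows possible: the head is treated by `Linear`,
  -- and the tail by the induction hypothesis for `F ∘ (r ∷_)`.
  fix-row : ∀ {F} r → Multilinear F → Multilinear (F ∘ (r ∷_))
  fix-row r ml = record { row-cong = row-cong ∘ (r ∷_) ; linear = linear ∘ (r ∷_) }
    where open Multilinear ml

  module Linear {F} (ml : Multilinear F) where
    open Multilinear ml

    head-cong : ∀ {r s} post → r ≋ s → F (r ∷ post) ≈ F (s ∷ post)
    head-cong = row-cong []

    rows-cong : ∀ {rs ss} → Pointwise _≋_ rs ss → F rs ≈ F ss
    rows-cong = go ml
      where
      go : ∀ {G} → Multilinear G → ∀ {rs ss} → Pointwise _≋_ rs ss → G rs ≈ G ss
      go _ [] = refl
      go mlG {r ∷ rs} (r≋s ∷ rest) = trans (go (fix-row r mlG) rest) (Multilinear.row-cong mlG [] _ r≋s)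

    head-⊕ : ∀ r s post → F ((r ⊕ s) ∷ post) ≈ F (r ∷ post) + F (s ∷ post)
    head-⊕ r s post = begin
      F ((r ⊕ s) ∷ post)               ≈⟨ head-cong post (λ j → +-congʳ (sym (*-identityˡ _))) ⟩
      F (((1# ⊙ r) ⊕ s) ∷ post)        ≈⟨ linear [] 1# r s post ⟩
      1# * F (r ∷ post) + F (s ∷ post) ≈⟨ +-congʳ (*-identityˡ _) ⟩
      F (r ∷ post) + F (s ∷ post)      ∎

    head-⊝ : ∀ r s post → F ((r ⊝ s) ∷ post) ≈ F (r ∷ post) - F (s ∷ post)
    head-⊝ r s post = begin
      F ((r ⊝ s) ∷ post)
        ≈⟨ head-cong post (λ j → solve 2 (λ a b → a :- b := :- con (+ 1) :* b :+ a) refl (r j) (s j)) ⟩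
      F ((((- 1#) ⊙ s) ⊕ r) ∷ post) ≈⟨ linear [] _ s r post ⟩
      - 1# * F (s ∷ post) + F (r ∷ post) ≈⟨ solve 2 (λ a b → :- con (+ 1) :* b :+ a := a :- b) refl _ _ ⟩
      F (r ∷ post) - F (s ∷ post)          ∎

    head-zero : ∀ r post → (∀ j → r j ≈ 0#) → F (r ∷ post) ≈ 0#
    head-zero r post r≈0 = begin
      F (r ∷ post)                ≈⟨ head-cong post (λ j → trans (r≈0 j) (sym (-‿inverseʳ (r j)))) ⟩
      F ((r ⊝ r) ∷ post)          ≈⟨ head-⊝ r r post ⟩
      F (r ∷ post) - F (r ∷ post) ≈⟨ -‿inverseʳ _ ⟩
      0#                          ∎

    head-⊙ : ∀ a r post → F ((a ⊙ r) ∷ post) ≈ a * F (r ∷ post)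
    head-⊙ a r post = begin
      F ((a ⊙ r) ∷ post)                        ≈⟨ head-cong post (λ j → sym (+-identityʳ _)) ⟩
      F (((a ⊙ r) ⊕ (λ _ → 0#)) ∷ post)         ≈⟨ linear [] a r _ post ⟩
      a * F (r ∷ post) + F ((λ _ → 0#) ∷ post)  ≈⟨ +-congˡ (head-zero _ post (λ _ → refl)) ⟩
      a * F (r ∷ post) + 0#                     ≈⟨ +-identityʳ _ ⟩
      a * F (r ∷ post)                          ∎

  swap : ∀ {F} → Multilinear F → Alternating F → ∀ r s post → F (r ∷ s ∷ post) ≈ - F (s ∷ r ∷ post)
  swap {F} ml alt r s post = +-inverseˡ-unique _ _ (begin
    F (r ∷ s ∷ post) + F (s ∷ r ∷ post)
      ≈⟨ +-cong (+-identityˡ _) (+-identityʳ _) ⟨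
    (0# + F (r ∷ s ∷ post)) + (F (s ∷ r ∷ post) + 0#)
      ≈⟨ +-cong (+-congʳ (alt [] r post)) (+-congˡ (alt [] s post)) ⟨
    (F (r ∷ r ∷ post) + F (r ∷ s ∷ post)) + (F (s ∷ r ∷ post) + F (s ∷ s ∷ post))
      ≈⟨ +-cong (Linear.head-⊕ (fix-row r ml) r s post) (Linear.head-⊕ (fix-row s ml) r s post) ⟨
    F (r ∷ (r ⊕ s) ∷ post) + F (s ∷ (r ⊕ s) ∷ post)
      ≈⟨ Linear.head-⊕ ml r s _ ⟨
    F ((r ⊕ s) ∷ (r ⊕ s) ∷ post)
      ≈⟨ alt [] (r ⊕ s) post ⟩
    0# ∎)

  -- `Alternating` speaks only of adjacent equal rows; swaps carry the first copy down to the
  -- second.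
  repeated-row : ∀ {F} → Multilinear F → Alternating F → ∀ r mid post → F (r ∷ mid ++ r ∷ post) ≈ 0#
  repeated-row ml alt r []        post = alt [] r post
  repeated-row {F} ml alt r (s ∷ mid) post = begin
    F (r ∷ s ∷ mid ++ r ∷ post)   ≈⟨ swap ml alt r s _ ⟩
    - F (s ∷ r ∷ mid ++ r ∷ post) ≈⟨ -‿cong (repeated-row (fix-row s ml) (alt ∘ (s ∷_)) r mid post) ⟩
    - 0#                          ≈⟨ -0#≈0# ⟩
    0#                            ∎

  subtract-row : ∀ {G} → Multilinear G → ∀ r → (∀ pre post → G (pre ++ r ∷ post) ≈ 0#) →
                 ∀ rs → G (map (_⊝ r) rs) ≈ G rs
  subtract-row     ml r kills []       = refl
  subtract-row {G} ml r kills (s ∷ rs) = begin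
    G ((s ⊝ r) ∷ map (_⊝ r) rs) ≈⟨ subtract-row (fix-row (s ⊝ r) ml) r (kills ∘ ((s ⊝ r) ∷_)) rs ⟩
    G ((s ⊝ r) ∷ rs)            ≈⟨ Linear.head-⊝ ml s r rs ⟩
    G (s ∷ rs) - G (r ∷ rs)     ≈⟨ +-congˡ (trans (-‿cong (kills [] rs)) -0#≈0#) ⟩
    G (s ∷ rs) + 0#             ≈⟨ +-identityʳ _ ⟩
    G (s ∷ rs)                  ∎

  differences : Row → List Row → List Row
  differences r []       = []
  differences r (s ∷ rs) = (s ⊝ r) ∷ differences s rs

  -- The tail is treated while `s` is still intact, so that every difference refers to original
  -- rows; only then is `s` itself changed, at the cost of a term with `r` repeated.
  subtract-previous : ∀ {F} → Multilinear F → Alternating F → ∀ r rs →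
                      F (r ∷ rs) ≈ F (r ∷ differences r rs)
  subtract-previous     ml alt r []       = refl
  subtract-previous {F} ml alt r (s ∷ rs) = begin
    F (r ∷ s ∷ rs)                      ≈⟨ subtract-previous (fix-row r ml) (alt ∘ (r ∷_)) s rs ⟩
    F (r ∷ s ∷ D)                       ≈⟨ +-identityʳ _ ⟨
    F (r ∷ s ∷ D) + 0#                  ≈⟨ +-congˡ (trans (-‿cong (alt [] r D)) -0#≈0#) ⟨
    F (r ∷ s ∷ D) - F (r ∷ r ∷ D)       ≈⟨ Linear.head-⊝ (fix-row r ml) s r D ⟨
    F (r ∷ (s ⊝ r) ∷ D)                 ∎
    where D = differences s rs

  -- Laplace expansion along column `j`, with `F` giving the minors. Either the head row is deleted,
  -- or it stays in the minor and the deleted row lies one place lower, whence the sign.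
  expand : ℕ → (List Row → Carrier) → List Row → Carrier
  expand j F []       = 0#
  expand j F (r ∷ rs) = r j * F rs - expand j (F ∘ (r ∷_)) rs

  -- The n × n determinant on the columns j, …, j + n - 1; zero unless there are exactly n rows.
  det : ℕ → ℕ → List Row → Carrier
  det zero    j []      = 1#
  det zero    j (_ ∷ _) = 0#
  det (suc n) j         = expand j (det n (suc j))

  expand-cong : ∀ j {F G} → (∀ rs → F rs ≈ G rs) → ∀ rs → expand j F rs ≈ expand j G rs
  expand-cong j F≈G []       = refl
  expand-cong j F≈G (r ∷ rs) =
    +-cong (*-congˡ (F≈G rs)) (-‿cong (expand-cong j (F≈G ∘ (r ∷_)) rs))

  expand-linear : ∀ j a {F G H} → (∀ rs → H rs ≈ a * F rs + G rs) →
                  ∀ rs → expand j H rs ≈ a * expand j F rs + expand j G rs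
  expand-linear j a H≈ []       = sym (trans (+-identityʳ _) (zeroʳ a))
  expand-linear j a {F} {G} {H} H≈ (r ∷ rs) = begin
    r j * H rs - expand j (H ∘ (r ∷_)) rs
      ≈⟨ +-cong (*-congˡ (H≈ rs)) (-‿cong (expand-linear j a (H≈ ∘ (r ∷_)) rs)) ⟩
    r j * (a * F rs + G rs) - (a * expand j (F ∘ (r ∷_)) rs + expand j (G ∘ (r ∷_)) rs)
      ≈⟨ solve 6 (λ x a f g u v → x :* (a :* f :+ g) :- (a :* u :+ v)
                                    := a :* (x :* f :- u) :+ (x :* g :- v)) refl
                 (r j) a (F rs) (G rs) _ _ ⟩
    a * expand j F (r ∷ rs) + expand j G (r ∷ rs) ∎

  expand-multilinear : ∀ j {F} → Multilinear F → Multilinear (expand j F)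
  expand-multilinear j ml = record { row-cong = row-cong′ ml ; linear = linear′ ml }
    where
    open Multilinear
    row-cong′ : ∀ {F} → Multilinear F → ∀ pre {r s} post → r ≋ s →
                expand j F (pre ++ r ∷ post) ≈ expand j F (pre ++ s ∷ post)
    row-cong′ ml []        post r≋s =
      +-cong (*-congʳ (r≋s j)) (-‿cong (expand-cong j (λ rs → row-cong ml [] rs r≋s) post))
    row-cong′ ml (p ∷ pre) post r≋s =
      +-cong (*-congˡ (row-cong ml pre post r≋s)) (-‿cong (row-cong′ (fix-row p ml) pre post r≋s))
    linear′ : ∀ {F} → Multilinear F → ∀ pre a r s post → expand j F (pre ++ ((a ⊙ r) ⊕ s) ∷ post)
                ≈ a * expand j F (pre ++ r ∷ post) + expand j F (pre ++ s ∷ post)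
    linear′ {F} ml []        a r s post = begin
      (a * r j + s j) * F post - expand j (F ∘ (((a ⊙ r) ⊕ s) ∷_)) post
        ≈⟨ +-congˡ (-‿cong (expand-linear j a (linear ml [] a r s) post)) ⟩
      (a * r j + s j) * F post - (a * expand j (F ∘ (r ∷_)) post + expand j (F ∘ (s ∷_)) post)
        ≈⟨ solve 6 (λ a x y f u v → (a :* x :+ y) :* f :- (a :* u :+ v)
                                      := a :* (x :* f :- u) :+ (y :* f :- v)) refl
                   a (r j) (s j) (F post) _ _ ⟩
      a * expand j F (r ∷ post) + expand j F (s ∷ post) ∎
    linear′ {F} ml (p ∷ pre) a r s post = begin
      p j * F (pre ++ ((a ⊙ r) ⊕ s) ∷ post) - expand j (F ∘ (p ∷_)) (pre ++ ((a ⊙ r) ⊕ s) ∷ post)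
        ≈⟨ +-cong (*-congˡ (linear ml pre a r s post)) (-‿cong (linear′ (fix-row p ml) pre a r s post)) ⟩
      p j * (a * F (pre ++ r ∷ post) + F (pre ++ s ∷ post))
        - (a * expand j (F ∘ (p ∷_)) (pre ++ r ∷ post) + expand j (F ∘ (p ∷_)) (pre ++ s ∷ post))
        ≈⟨ solve 6 (λ x a f g u v → x :* (a :* f :+ g) :- (a :* u :+ v)
                                      := a :* (x :* f :- u) :+ (x :* g :- v)) refl
                   (p j) a _ _ _ _ ⟩
      a * expand j F (p ∷ pre ++ r ∷ post) + expand j F (p ∷ pre ++ s ∷ post) ∎

  expand-zero : ∀ j {F} → (∀ rs → F rs ≈ 0#) → ∀ rs → expand j F rs ≈ 0#
  expand-zero j F≈0 []       = refl
  expand-zero j F≈0 (r ∷ rs) = trans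
    (+-cong (trans (*-congˡ (F≈0 rs)) (zeroʳ _)) (trans (-‿cong (expand-zero j (F≈0 ∘ (r ∷_)) rs)) -0#≈0#))
    (+-identityʳ _)

  -- Deleting either of the two equal rows gives the same minor with opposite signs; every other
  -- minor still contains both or vanishes by recursion on the prefix.
  expand-alternating : ∀ j {F} → Alternating F → Alternating (expand j F)
  expand-alternating j {F} alt [] r post = begin
    r j * F (r ∷ post) - (r j * F (r ∷ post) - expand j (F ∘ (r ∷_) ∘ (r ∷_)) post)
      ≈⟨ +-congˡ (-‿cong (+-congˡ (-‿cong (expand-zero j (alt [] r) post)))) ⟩
    r j * F (r ∷ post) - (r j * F (r ∷ post) - 0#)
      ≈⟨ solve 1 (λ x → x :- (x :- con (+ 0)) := con (+ 0)) refl _ ⟩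
    0# ∎
  expand-alternating j {F} alt (p ∷ pre) r post = begin
    p j * F (pre ++ r ∷ r ∷ post) - expand j (F ∘ (p ∷_)) (pre ++ r ∷ r ∷ post)
      ≈⟨ +-cong (*-congˡ (alt pre r post)) (-‿cong (expand-alternating j (alt ∘ (p ∷_)) pre r post)) ⟩
    p j * 0# - 0#  ≈⟨ +-cong (zeroʳ _) -0#≈0# ⟩
    0# + 0#        ≈⟨ +-identityʳ _ ⟩
    0#             ∎

  det-zero-∷ : ∀ j pre r post → det 0 j (pre ++ r ∷ post) ≈ 0#
  det-zero-∷ j []      r post = refl
  det-zero-∷ j (_ ∷ _) r post = refl

  det-multilinear : ∀ n j → Multilinear (det n j)
  det-multilinear zero j = record
    { row-cong = λ pre {r} {s} post _ → trans (det-zero-∷ j pre r post) (sym (det-zero-∷ j pre s post))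
    ; linear   = λ pre a r s post → trans (det-zero-∷ j pre _ post) (sym (trans
        (+-cong (trans (*-congˡ (det-zero-∷ j pre r post)) (zeroʳ a)) (det-zero-∷ j pre s post)) (+-identityʳ _)))
    }
  det-multilinear (suc n) j = expand-multilinear j (det-multilinear n (suc j))

  det-alternating : ∀ n j → Alternating (det n j)
  det-alternating zero    j pre r post = det-zero-∷ j pre r (r ∷ post)
  det-alternating (suc n) j = expand-alternating j (det-alternating n (suc j))

  expand-shift : ∀ j {F G} → (∀ rs → F rs ≈ G (map (_∘ suc) rs)) →
                 ∀ rs → expand (suc j) F rs ≈ expand j G (map (_∘ suc) rs)
  expand-shift j F≈G []       = refl
  expand-shift j F≈G (r ∷ rs) =
    +-cong (*-congˡ (F≈G rs)) (-‿cong (expand-shift j (F≈G ∘ (r ∷_)) rs))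

  det-shift : ∀ n j rs → det n (suc j) rs ≈ det n j (map (_∘ suc) rs)
  det-shift zero    j []      = refl
  det-shift zero    j (_ ∷ _) = refl
  det-shift (suc n) j         = expand-shift j (det-shift n (suc j))

  expand-zero-column : ∀ j {F} rs → All (λ r → r j ≈ 0#) rs → expand j F rs ≈ 0#
  expand-zero-column j     []       []             = refl
  expand-zero-column j {F} (r ∷ rs) (rj≈0 ∷ rest) = trans
    (+-cong (trans (*-congʳ rj≈0) (zeroˡ _)) (trans (-‿cong (expand-zero-column j rs rest)) -0#≈0#))
    (+-identityʳ _)

  det-unit-column : ∀ n r rs → r 0 ≈ 1# → All (λ s → s 0 ≈ 0#) rs →
                    det (suc n) 0 (r ∷ rs) ≈ det n 0 (map (_∘ suc) rs)
  det-unit-column n r rs r₀ rs₀ = begin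
    r 0 * det n 1 rs - expand 0 (det n 1 ∘ (r ∷_)) rs ≈⟨ +-cong (*-congʳ r₀) (-‿cong (expand-zero-column 0 rs rs₀)) ⟩
    1# * det n 1 rs - 0#        ≈⟨ solve 1 (λ x → con (+ 1) :* x :- con (+ 0) := x) refl _ ⟩
    det n 1 rs                  ≈⟨ det-shift n 0 rs ⟩
    det n 0 (map (_∘ suc) rs)   ∎

  columnProduct : (ℕ → Carrier) → ℕ → ℕ → Carrier
  columnProduct γ zero    j = 1#
  columnProduct γ (suc n) j = γ j * columnProduct γ n (suc j)

  scaleColumns : (ℕ → Carrier) → Row → Row
  scaleColumns γ r j = γ j * r j

  expand-scale : ∀ γ K j {F G} → (∀ rs → F (map (scaleColumns γ) rs) ≈ K * G rs) →
                 ∀ rs → expand j F (map (scaleColumns γ) rs) ≈ (γ j * K) * expand j G rs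
  expand-scale γ K j F≈ []       = sym (zeroʳ _)
  expand-scale γ K j {F} {G} F≈ (r ∷ rs) = begin
    γ j * r j * F (map (scaleColumns γ) rs) - expand j (F ∘ (scaleColumns γ r ∷_)) (map (scaleColumns γ) rs)
      ≈⟨ +-cong (*-congˡ (F≈ rs)) (-‿cong (expand-scale γ K j (F≈ ∘ (r ∷_)) rs)) ⟩
    γ j * r j * (K * G rs) - (γ j * K) * expand j (G ∘ (r ∷_)) rs
      ≈⟨ solve 5 (λ g x k f u → g :* x :* (k :* f) :- (g :* k) :* u := (g :* k) :* (x :* f :- u)) refl
                 (γ j) (r j) K (G rs) _ ⟩
    (γ j * K) * expand j G (r ∷ rs) ∎

  det-scale : ∀ γ n j rs → det n j (map (scaleColumns γ) rs) ≈ columnProduct γ n j * det n j rs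
  det-scale γ zero    j []       = sym (*-identityˡ _)
  det-scale γ zero    j (_ ∷ _)  = sym (zeroʳ _)
  det-scale γ (suc n) j          = expand-scale γ _ j (det-scale γ n (suc j))

  -- The Newton basis; the offsets β make the family closed under divided differences.
  newton : (τ β : ℕ → Carrier) → Carrier → Row
  newton τ β z zero    = 1#
  newton τ β z (suc j) = (z - τ j) * newton τ β z j + β j

  -- The Leibniz rule for divided differences. Its second summand is the value at `a`, constant in
  -- `z`, and becomes the new offset; the old offsets cancel.
  newton-difference : ∀ τ β a z j → newton τ β z (suc j) - newton τ β a (suc j)
    ≈ (z - a) * newton (τ ∘ suc) (λ i → newton τ β a (suc i)) z j
  newton-difference τ β a z zero =
    solve 4 (λ z a t b → ((z :- t) :* con (+ 1) :+ b) :- ((a :- t) :* con (+ 1) :+ b) := (z :- a) :* con (+ 1)) refl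
          z a (τ 0) (β 0)
  newton-difference τ β a z (suc j) = begin
    ((z - t) * p + b) - ((a - t) * p′ + b)
      ≈⟨ solve 6 (λ z a t b p p′ → ((z :- t) :* p :+ b) :- ((a :- t) :* p′ :+ b)
                                     := (z :- t) :* (p :- p′) :+ (z :- a) :* p′) refl z a t b p p′ ⟩
    (z - t) * (p - p′) + (z - a) * p′
      ≈⟨ +-congʳ (*-congˡ (newton-difference τ β a z j)) ⟩
    (z - t) * ((z - a) * n) + (z - a) * p′
      ≈⟨ solve 5 (λ z a t n p′ → (z :- t) :* ((z :- a) :* n) :+ (z :- a) :* p′
                                   := (z :- a) :* ((z :- t) :* n :+ p′)) refl z a t n p′ ⟩
    (z - a) * ((z - t) * n + p′) ∎
    where
    t  = τ (suc j)
    b  = β (suc j)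
    p  = newton τ β z (suc j)
    p′ = newton τ β a (suc j)
    n  = newton (τ ∘ suc) (λ i → newton τ β a (suc i)) z j

  scale-rows : ∀ {F} → Multilinear F → ∀ (f : Carrier → Carrier) (ρ : Carrier → Row) zs →
               F (map (λ z → f z ⊙ ρ z) zs) ≈ prod R (map f zs) * F (map ρ zs)
  scale-rows     ml f ρ []       = sym (*-identityˡ _)
  scale-rows {F} ml f ρ (z ∷ zs) = begin
    F ((f z ⊙ ρ z) ∷ map (λ z → f z ⊙ ρ z) zs)      ≈⟨ Linear.head-⊙ ml (f z) (ρ z) _ ⟩
    f z * F (ρ z ∷ map (λ z → f z ⊙ ρ z) zs)        ≈⟨ *-congˡ (scale-rows (fix-row (ρ z) ml) f ρ zs) ⟩
    f z * (prod R (map f zs) * F (ρ z ∷ map ρ zs)) ≈⟨ *-assoc _ _ _ ⟨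
    prod R (map f (z ∷ zs)) * F (map ρ (z ∷ zs))   ∎

  vandermonde : List Carrier → Carrier
  vandermonde []       = 1#
  vandermonde (a ∷ zs) = prod R (map (_- a) zs) * vandermonde zs

  -- Subtracting the first row makes every other row divisible by its `z - a`, and the quotients
  -- again form a Newton family, with shifted points and new offsets. The offsets of the quotients
  -- are in general nonzero, so the induction must allow arbitrary `β`.
  det-newton : ∀ τ β zs → det (length zs) 0 (map (newton τ β) zs) ≈ vandermonde zs
  det-newton τ β []       = refl
  det-newton τ β (a ∷ zs) = begin
    det (suc n) 0 (r ∷ map (newton τ β) zs)
      ≈⟨ subtract-row (fix-row r (det-multilinear (suc n) 0)) r
           (λ pre post → repeated-row (det-multilinear (suc n) 0) (det-alternating (suc n) 0) r pre post) _ ⟨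
    det (suc n) 0 (r ∷ map (_⊝ r) (map (newton τ β) zs))
      ≈⟨ det-unit-column n r _ refl (unit zs) ⟩
    det n 0 (map (_∘ suc) (map (_⊝ r) (map (newton τ β) zs)))
      ≈⟨ Linear.rows-cong (det-multilinear n 0) (quotients zs) ⟩
    det n 0 (map (λ z → (z - a) ⊙ newton τ′ β′ z) zs)
      ≈⟨ scale-rows (det-multilinear n 0) (_- a) (newton τ′ β′) zs ⟩
    prod R (map (_- a) zs) * det n 0 (map (newton τ′ β′) zs)
      ≈⟨ *-congˡ (det-newton τ′ β′ zs) ⟩
    prod R (map (_- a) zs) * vandermonde zs ∎
    where
    n  = length zs
    r  = newton τ β a
    τ′ = τ ∘ suc
    β′ = λ i → newton τ β a (suc i)
    unit : ∀ zs → All (λ s → s 0 ≈ 0#) (map (_⊝ r) (map (newton τ β) zs))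
    unit []       = []
    unit (z ∷ zs) = -‿inverseʳ 1# ∷ unit zs
    quotients : ∀ zs → Pointwise _≋_ (map (_∘ suc) (map (_⊝ r) (map (newton τ β) zs)))
                                     (map (λ z → (z - a) ⊙ newton τ′ β′ z) zs)
    quotients []       = []
    quotients (z ∷ zs) = newton-difference τ β a z ∷ quotients zs

-- Calculus of q-integers and the antiderivative of the lozenge weight.

module QCalculus {c ℓ : Level} (R : CommutativeRing c ℓ) where
  open CommutativeRing R
  open IntegerSolver R using (solve; _:=_; _:+_; _:*_; _:-_; :-_; con)
  open Determinants R
  open import Data.Nat as ℕ using (ℕ; zero; suc)
  open import Data.Integer as ℤ using (ℤ; +_; -[1+_])
  import Data.Integer.Properties as ℤP
  import Data.Integer.Solver as ℤS
  open import Data.List using (applyUpTo)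
  open import Data.List.Properties using (map-upTo)
  open import Function using (_∘_)
  open import Relation.Binary.PropositionalEquality as ≡ using (_≡_)
  open import Algebra.Properties.Ring ring
  open import Relation.Binary.Reasoning.Setoid setoid
  open ℤS.+-*-Solver using ()
    renaming (solve to solveℤ; _:=_ to _≔_; _:+_ to _⊹_; _:*_ to _⋆_; _:-_ to _∸_; :-_ to ∸_; con to #_)

  sumUpTo : (ℕ → Carrier) → ℕ → Carrier
  sumUpTo f n = sumR R (applyUpTo f n)

  sumUpTo-last : ∀ f n → sumUpTo f (suc n) ≈ sumUpTo f n + f n
  sumUpTo-last f zero    = +-comm _ _
  sumUpTo-last f (suc n) = trans (+-congˡ (sumUpTo-last (f ∘ suc) n)) (sym (+-assoc _ _ _))

  sumUpTo-scale : ∀ a {f g} n → (∀ j → f j ≈ a * g j) → sumUpTo f n ≈ a * sumUpTo g n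
  sumUpTo-scale a zero    f≈ = sym (zeroʳ a)
  sumUpTo-scale a (suc n) f≈ = trans (+-cong (f≈ 0) (sumUpTo-scale a n (f≈ ∘ suc))) (sym (distribˡ a _ _))

  module QIntegers (q qi h X Y : Carrier) (q*qi≈1 : q * qi ≈ 1#) where

    infix 7.5 q^_
    q^_ : ℤ → Carrier
    q^_ = zpow R q qi

    q^-cong : ∀ {m n} → m ≡ n → q^ m ≈ q^ n
    q^-cong m≡n = reflexive (≡.cong q^_ m≡n)

    cancel-q : ∀ a → q * (qi * a) ≈ a
    cancel-q a = trans (sym (*-assoc _ _ _)) (trans (*-congʳ q*qi≈1) (*-identityˡ a))

    cancel-qi : ∀ a → qi * (q * a) ≈ a
    cancel-qi a = trans (sym (*-assoc _ _ _)) (trans (*-congʳ (trans (*-comm _ _) q*qi≈1)) (*-identityˡ a))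

    q^-suc : ∀ z → q^ (+ 1 ℤ.+ z) ≈ q * q^ z
    q^-suc (+ n)          = refl
    q^-suc -[1+ zero ]    = sym (cancel-q 1#)
    q^-suc -[1+ suc n ]   = sym (cancel-q _)

    q^-pred : ∀ z → q^ (ℤ.-1ℤ ℤ.+ z) ≈ qi * q^ z
    q^-pred z = trans (sym (cancel-qi _)) (*-congˡ (trans (sym (q^-suc (ℤ.-1ℤ ℤ.+ z))) (q^-cong (ℤP.suc-pred z))))

    q^-+ : ∀ m n → q^ (m ℤ.+ n) ≈ q^ m * q^ n
    q^-+ (+ zero)     n = trans (q^-cong (ℤP.+-identityˡ n)) (sym (*-identityˡ _))
    q^-+ (+ suc m)    n = begin
      q^ (+ suc m ℤ.+ n)         ≈⟨ q^-cong (ℤP.+-assoc (+ 1) (+ m) n) ⟩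
      q^ (+ 1 ℤ.+ (+ m ℤ.+ n))   ≈⟨ q^-suc (+ m ℤ.+ n) ⟩
      q * q^ (+ m ℤ.+ n)         ≈⟨ *-congˡ (q^-+ (+ m) n) ⟩
      q * (q^ + m * q^ n)        ≈⟨ *-assoc _ _ _ ⟨
      q^ + suc m * q^ n          ∎
    q^-+ -[1+ zero ]  n = trans (q^-pred n) (*-congʳ (sym (*-identityʳ qi)))
    q^-+ -[1+ suc m ] n = begin
      q^ (-[1+ suc m ] ℤ.+ n)          ≈⟨ q^-cong (ℤP.+-assoc ℤ.-1ℤ -[1+ m ] n) ⟩
      q^ (ℤ.-1ℤ ℤ.+ (-[1+ m ] ℤ.+ n))  ≈⟨ q^-pred (-[1+ m ] ℤ.+ n) ⟩
      qi * q^ (-[1+ m ] ℤ.+ n)         ≈⟨ *-congˡ (q^-+ -[1+ m ] n) ⟩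
      qi * (q^ -[1+ m ] * q^ n)        ≈⟨ *-assoc _ _ _ ⟨
      q^ -[1+ suc m ] * q^ n           ∎

    exponent : ℕ → ℕ → ℤ
    exponent n j = + n ℤ.- + 1 ℤ.- + 2 ℤ.* + j

    ⟨_⟩ : ℕ → Carrier
    ⟨_⟩ = qint R q qi

    ⟨⟩-sum : ∀ n → ⟨ n ⟩ ≈ sumUpTo (λ j → q^ exponent n j) n
    ⟨⟩-sum n = reflexive (≡.cong (sumR R) (map-upTo (λ j → q^ exponent n j) n))

    ⟨suc⟩-last : ∀ n → ⟨ suc n ⟩ ≈ q * ⟨ n ⟩ + q^ (ℤ.- + n)
    ⟨suc⟩-last n = begin
      ⟨ suc n ⟩                                     ≈⟨ ⟨⟩-sum (suc n) ⟩
      sumUpTo (λ j → q^ exponent (suc n) j) (suc n) ≈⟨ sumUpTo-last _ n ⟩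
      sumUpTo (λ j → q^ exponent (suc n) j) n + q^ exponent (suc n) n
        ≈⟨ +-cong (trans (sumUpTo-scale q n term) (*-congˡ (sym (⟨⟩-sum n)))) (q^-cong last) ⟩
      q * ⟨ n ⟩ + q^ (ℤ.- + n) ∎
      where
      term : ∀ j → q^ exponent (suc n) j ≈ q * q^ exponent n j
      term j = trans
        (q^-cong (solveℤ 2 (λ n j → # (+ 1) ⊹ n ∸ # (+ 1) ∸ # (+ 2) ⋆ j ≔ # (+ 1) ⊹ (n ∸ # (+ 1) ∸ # (+ 2) ⋆ j))
                 ≡.refl (+ n) (+ j)))
        (q^-suc (exponent n j))
      last : exponent (suc n) n ≡ ℤ.- + n
      last = solveℤ 1 (λ n → # (+ 1) ⊹ n ∸ # (+ 1) ∸ # (+ 2) ⋆ n ≔ ∸ n) ≡.refl (+ n)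

    ⟨suc⟩-first : ∀ n → ⟨ suc n ⟩ ≈ qi * ⟨ n ⟩ + q^ (+ n)
    ⟨suc⟩-first n = begin
      ⟨ suc n ⟩                                     ≈⟨ ⟨⟩-sum (suc n) ⟩
      q^ exponent (suc n) 0 + sumUpTo (λ j → q^ exponent (suc n) (suc j)) n
        ≈⟨ +-cong (q^-cong first) (trans (sumUpTo-scale qi n term) (*-congˡ (sym (⟨⟩-sum n)))) ⟩
      q^ (+ n) + qi * ⟨ n ⟩ ≈⟨ +-comm _ _ ⟩
      qi * ⟨ n ⟩ + q^ (+ n) ∎
      where
      term : ∀ j → q^ exponent (suc n) (suc j) ≈ qi * q^ exponent n j
      term j = trans
        (q^-cong (solveℤ 2 (λ n j → # (+ 1) ⊹ n ∸ # (+ 1) ∸ # (+ 2) ⋆ (# (+ 1) ⊹ j)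
                              ≔ # ℤ.-1ℤ ⊹ (n ∸ # (+ 1) ∸ # (+ 2) ⋆ j)) ≡.refl (+ n) (+ j)))
        (q^-pred (exponent n j))
      first : exponent (suc n) 0 ≡ + n
      first = solveℤ 1 (λ n → # (+ 1) ⊹ n ∸ # (+ 1) ∸ # (+ 2) ⋆ # (+ 0) ≔ n) ≡.refl (+ n)

    A : ℤ → Carrier
    A = hw R q qi h X Y

    A-cong : ∀ {m n} → m ≡ n → A m ≈ A n
    A-cong m≡n = reflexive (≡.cong A m≡n)

    -- A discrete antiderivative of A: formally Ψ z = (X qᶻ - Y q⁻ᶻ) / 2(q - q⁻¹), but q - q⁻¹ need not be invertible.
    Ψ : ℤ → Carrier
    Ψ (+ 0)           = 0#
    Ψ (+ 1)           = 0#
    Ψ (+ suc (suc n)) = Ψ (+ n) + A (+ suc n)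
    Ψ -[1+ 0 ]           = Ψ (+ 1) - A (+ 0)
    Ψ -[1+ 1 ]           = Ψ (+ 0) - A -[1+ 0 ]
    Ψ -[1+ suc (suc n) ] = Ψ -[1+ n ] - A -[1+ suc n ]

    Ψ-cong : ∀ {m n} → m ≡ n → Ψ m ≈ Ψ n
    Ψ-cong m≡n = reflexive (≡.cong Ψ m≡n)

    -- Even and odd arguments form two separate chains, each with an arbitrary base value 0; this is
    -- enough because only differences at arguments of equal parity, such as m + n and m - n, are
    -- evaluated.
    Ψ-step : ∀ z → Ψ (+ 2 ℤ.+ z) ≈ Ψ z + A (+ 1 ℤ.+ z)
    Ψ-step (+ n)              = refl
    Ψ-step -[1+ 0 ]           = sym (//-rightDividesˡ _ _)
    Ψ-step -[1+ 1 ]           = sym (//-rightDividesˡ _ _)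
    Ψ-step -[1+ suc (suc n) ] = sym (//-rightDividesˡ _ _)

    -- The X-part uses the recursion that multiplies ⟨n⟩ by `q`, the Y-part the mirrored one with
    -- `qi`. Both powers of `q` in the weight thus move from m to m + 1 together.
    A*⟨suc⟩ : ∀ m n → A m * ⟨ suc n ⟩ ≈ A (+ 1 ℤ.+ m) * ⟨ n ⟩ + A (m ℤ.- + n)
    A*⟨suc⟩ m n = begin
      h * (X * a + Y * b) * ⟨ suc n ⟩
        ≈⟨ solve 6 (λ h X Y a b s → h :* (X :* a :+ Y :* b) :* s
                                      := h :* X :* a :* s :+ h :* Y :* b :* s) refl h X Y a b _ ⟩
      h * X * a * ⟨ suc n ⟩ + h * Y * b * ⟨ suc n ⟩
        ≈⟨ +-cong (*-congˡ (⟨suc⟩-last n)) (*-congˡ (⟨suc⟩-first n)) ⟩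
      h * X * a * (q * ⟨ n ⟩ + q^ (ℤ.- + n)) + h * Y * b * (qi * ⟨ n ⟩ + q^ (+ n))
        ≈⟨ solve 10 (λ h X Y a b q qi s u v → h :* X :* a :* (q :* s :+ u) :+ h :* Y :* b :* (qi :* s :+ v)
              := h :* (X :* (q :* a) :+ Y :* (qi :* b)) :* s :+ h :* (X :* (a :* u) :+ Y :* (b :* v)))
              refl h X Y a b q qi ⟨ n ⟩ (q^ (ℤ.- + n)) (q^ (+ n)) ⟩
      h * (X * (q * a) + Y * (qi * b)) * ⟨ n ⟩ + h * (X * (a * q^ (ℤ.- + n)) + Y * (b * q^ (+ n)))
        ≈⟨ +-cong (*-congʳ (*-congˡ (+-cong (*-congˡ (q^-suc m)) (*-congˡ lower))))
                  (*-congˡ (+-cong (*-congˡ (q^-+ m (ℤ.- + n))) (*-congˡ upper))) ⟨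
      A (+ 1 ℤ.+ m) * ⟨ n ⟩ + A (m ℤ.- + n) ∎
      where
      a = q^ m
      b = q^ (ℤ.- m)
      lower : q^ (ℤ.- (+ 1 ℤ.+ m)) ≈ qi * b
      lower = trans (q^-cong (ℤP.neg-distrib-+ (+ 1) m)) (q^-pred (ℤ.- m))
      upper : q^ (ℤ.- (m ℤ.- + n)) ≈ b * q^ (+ n)
      upper = trans (q^-cong (solveℤ 2 (λ m n → ∸ (m ∸ n) ≔ ∸ m ⊹ n) ≡.refl m (+ n))) (q^-+ (ℤ.- m) (+ n))

    -- The induction on `n` moves the centre to m + 1: the upper end is then already right, and the
    -- lower end is off by a single step of `Ψ`, which the extra weight corrects.
    A*⟨⟩ : ∀ n m → A m * ⟨ n ⟩ ≈ Ψ (m ℤ.+ + n) - Ψ (m ℤ.- + n)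
    A*⟨⟩ zero    m = trans (zeroʳ _) (sym (-‿inverseʳ _))
    A*⟨⟩ (suc n) m = begin
      A m * ⟨ suc n ⟩                             ≈⟨ A*⟨suc⟩ m n ⟩
      A (+ 1 ℤ.+ m) * ⟨ n ⟩ + A (m ℤ.- + n)       ≈⟨ +-congʳ (A*⟨⟩ n (+ 1 ℤ.+ m)) ⟩
      (Ψ (+ 1 ℤ.+ m ℤ.+ + n) - Ψ (+ 1 ℤ.+ m ℤ.- + n)) + A (m ℤ.- + n)
        ≈⟨ +-congʳ (+-congˡ (-‿cong (trans (Ψ-cong e₁) (Ψ-step (m ℤ.- + suc n))))) ⟩
      (Ψ (+ 1 ℤ.+ m ℤ.+ + n) - (Ψ (m ℤ.- + suc n) + A (+ 1 ℤ.+ (m ℤ.- + suc n)))) + A (m ℤ.- + n)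
        ≈⟨ +-cong (+-cong (Ψ-cong e₂) (-‿cong (+-congˡ (A-cong e₃)))) refl ⟩
      (Ψ (m ℤ.+ + suc n) - (Ψ (m ℤ.- + suc n) + A (m ℤ.- + n))) + A (m ℤ.- + n)
        ≈⟨ solve 3 (λ u v w → (u :- (v :+ w)) :+ w := u :- v) refl _ _ _ ⟩
      Ψ (m ℤ.+ + suc n) - Ψ (m ℤ.- + suc n) ∎
      where
      e₁ : + 1 ℤ.+ m ℤ.- + n ≡ + 2 ℤ.+ (m ℤ.- + suc n)
      e₁ = solveℤ 2 (λ m n → # (+ 1) ⊹ m ∸ n ≔ # (+ 2) ⊹ (m ∸ (# (+ 1) ⊹ n))) ≡.refl m (+ n)
      e₂ : + 1 ℤ.+ m ℤ.+ + n ≡ m ℤ.+ + suc n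
      e₂ = solveℤ 2 (λ m n → # (+ 1) ⊹ m ⊹ n ≔ m ⊹ (# (+ 1) ⊹ n)) ≡.refl m (+ n)
      e₃ : + 1 ℤ.+ (m ℤ.- + suc n) ≡ m ℤ.- + n
      e₃ = solveℤ 2 (λ m n → # (+ 1) ⊹ (m ∸ (# (+ 1) ⊹ n)) ≔ m ∸ n) ≡.refl m (+ n)

    -- The odd extension of the q-integers. Basis functions of degree above `v` contain factors with
    -- negative v - i, and the identities should hold there without case distinctions.
    ⟦_⟧ : ℤ → Carrier
    ⟦ + n ⟧      = ⟨ n ⟩
    ⟦ -[1+ n ] ⟧ = - ⟨ suc n ⟩

    A*⟦⟧ : ∀ m n → A m * ⟦ n ⟧ ≈ Ψ (m ℤ.+ n) - Ψ (m ℤ.- n)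
    A*⟦⟧ m (+ n)    = A*⟨⟩ n m
    A*⟦⟧ m -[1+ n ] = begin
      A m * - ⟨ suc n ⟩                         ≈⟨ -‿distribʳ-* _ _ ⟨
      - (A m * ⟨ suc n ⟩)                       ≈⟨ -‿cong (A*⟨⟩ (suc n) m) ⟩
      - (Ψ (m ℤ.+ + suc n) - Ψ (m ℤ.- + suc n)) ≈⟨ solve 2 (λ u v → :- (u :- v) := v :- u) refl _ _ ⟩
      Ψ (m ℤ.- + suc n) - Ψ (m ℤ.+ + suc n)     ∎

    -- The Newton basis on a lattice line.

    node : ℤ → ℕ → Carrier
    node a v = Ψ (+ 2 ℤ.* + v ℤ.+ a)

    -- With the nodes 0, 1, ... of the same line as interpolation points, every factor is a
    -- difference of two nodes and hence a weight times a q-integer: an analogue of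
    -- v(v-1)...(v-j+1).
    basis : ℤ → ℕ → Row
    basis a v = newton (node a) (λ _ → 0#) (node a v)

    weights : ℤ → ℕ → Carrier
    weights e zero    = 1#
    weights e (suc j) = weights e j * A (e ℤ.+ + j)

    gaps : ℤ → ℕ → Carrier
    gaps v zero    = 1#
    gaps v (suc j) = gaps v j * ⟦ v ℤ.- + j ⟧

    weights-head : ∀ e j → weights e (suc j) ≈ A e * weights (+ 1 ℤ.+ e) j
    weights-head e zero    = trans (*-identityˡ _) (trans (A-cong (ℤP.+-identityʳ e)) (sym (*-identityʳ _)))
    weights-head e (suc j) = begin
      weights e (suc j) * A (e ℤ.+ + suc j)                       ≈⟨ *-cong (weights-head e j) (A-cong shift) ⟩
      A e * weights (+ 1 ℤ.+ e) j * A (+ 1 ℤ.+ e ℤ.+ + j)         ≈⟨ *-assoc _ _ _ ⟩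
      A e * (weights (+ 1 ℤ.+ e) j * A (+ 1 ℤ.+ e ℤ.+ + j))       ∎
      where
      shift : e ℤ.+ + suc j ≡ + 1 ℤ.+ e ℤ.+ + j
      shift = solveℤ 2 (λ e j → e ⊹ (# (+ 1) ⊹ j) ≔ # (+ 1) ⊹ e ⊹ j) ≡.refl e (+ j)

    gaps-head : ∀ v j → gaps (+ 1 ℤ.+ v) (suc j) ≈ ⟦ + 1 ℤ.+ v ⟧ * gaps v j
    gaps-head v zero    = trans (*-identityˡ _)
      (trans (reflexive (≡.cong ⟦_⟧ (ℤP.+-identityʳ (+ 1 ℤ.+ v)))) (sym (*-identityʳ _)))
    gaps-head v (suc j) = begin
      gaps (+ 1 ℤ.+ v) (suc j) * ⟦ + 1 ℤ.+ v ℤ.- + suc j ⟧  ≈⟨ *-cong (gaps-head v j) (reflexive (≡.cong ⟦_⟧ shift)) ⟩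
      ⟦ + 1 ℤ.+ v ⟧ * gaps v j * ⟦ v ℤ.- + j ⟧              ≈⟨ *-assoc _ _ _ ⟩
      ⟦ + 1 ℤ.+ v ⟧ * (gaps v j * ⟦ v ℤ.- + j ⟧)            ∎
      where
      shift : + 1 ℤ.+ v ℤ.- + suc j ≡ v ℤ.- + j
      shift = solveℤ 2 (λ v j → # (+ 1) ⊹ v ∸ (# (+ 1) ⊹ j) ≔ v ∸ j) ≡.refl v (+ j)

    node-difference : ∀ a v i → node a v - node a i ≈ A (+ v ℤ.+ a ℤ.+ + i) * ⟦ + v ℤ.- + i ⟧
    node-difference a v i = sym (trans
      (A*⟦⟧ (+ v ℤ.+ a ℤ.+ + i) (+ v ℤ.- + i)) (+-cong (Ψ-cong upper) (-‿cong (Ψ-cong lower))))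
      where
      upper : + v ℤ.+ a ℤ.+ + i ℤ.+ (+ v ℤ.- + i) ≡ + 2 ℤ.* + v ℤ.+ a
      upper = solveℤ 3 (λ v a i → v ⊹ a ⊹ i ⊹ (v ∸ i) ≔ # (+ 2) ⋆ v ⊹ a) ≡.refl (+ v) a (+ i)
      lower : + v ℤ.+ a ℤ.+ + i ℤ.- (+ v ℤ.- + i) ≡ + 2 ℤ.* + i ℤ.+ a
      lower = solveℤ 3 (λ v a i → v ⊹ a ⊹ i ∸ (v ∸ i) ≔ # (+ 2) ⋆ i ⊹ a) ≡.refl (+ v) a (+ i)

    basis-product : ∀ a v j → basis a v j ≈ weights (+ v ℤ.+ a) j * gaps (+ v) j
    basis-product a v zero    = sym (*-identityˡ _)
    basis-product a v (suc j) = begin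
      (node a v - node a j) * basis a v j + 0#
        ≈⟨ +-identityʳ _ ⟩
      (node a v - node a j) * basis a v j
        ≈⟨ *-cong (node-difference a v j) (basis-product a v j) ⟩
      A (+ v ℤ.+ a ℤ.+ + j) * ⟦ + v ℤ.- + j ⟧ * (weights (+ v ℤ.+ a) j * gaps (+ v) j)
        ≈⟨ solve 4 (λ x y w g → x :* y :* (w :* g) := w :* x :* (g :* y)) refl _ _ _ _ ⟩
      weights (+ v ℤ.+ a) (suc j) * gaps (+ v) (suc j) ∎

    -- Both functions at `a - 1` contain `basis a v j`: passing from v to v + 1 loses a factor at
    -- one end of each product and gains one at the other. After division by it, an identity between
    -- three products of a weight and a q-integer remains, that is, between differences of `Ψ`.
    basis-step : ∀ a v j → basis (a ℤ.- + 1) (suc v) (suc j)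
      ≈ basis (a ℤ.- + 1) v (suc j) + A (+ 2 ℤ.* + v ℤ.+ a) * (⟨ suc j ⟩ * basis a v j)
    basis-step a v j = begin
      basis a′ (suc v) (suc j)
        ≈⟨ basis-product a′ (suc v) (suc j) ⟩
      weights (+ suc v ℤ.+ a′) (suc j) * gaps (+ suc v) (suc j)
        ≈⟨ *-cong (reflexive (≡.cong (λ e → weights e (suc j)) e₁)) (gaps-head (+ v) j) ⟩
      (W * A (e ℤ.+ + j)) * (⟦ + suc v ⟧ * N)
        ≈⟨ solve 4 (λ w x y n → (w :* x) :* (y :* n) := (w :* n) :* (x :* y)) refl W _ _ N ⟩
      (W * N) * (A (e ℤ.+ + j) * ⟦ + suc v ⟧)
        ≈⟨ *-congˡ telescope ⟩
      (W * N) * (A (ℤ.-1ℤ ℤ.+ e) * ⟦ + v ℤ.- + j ⟧ + A (+ 2 ℤ.* + v ℤ.+ a) * ⟨ suc j ⟩)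
        ≈⟨ solve 6 (λ w n x y z s → (w :* n) :* (x :* y :+ z :* s) := (x :* w) :* (n :* y) :+ z :* (s :* (w :* n)))
             refl W N _ _ _ _ ⟩
      (A (ℤ.-1ℤ ℤ.+ e) * W) * gaps (+ v) (suc j) + A (+ 2 ℤ.* + v ℤ.+ a) * (⟨ suc j ⟩ * (W * N))
        ≈⟨ +-cong (*-congʳ lower) (*-congˡ (*-congˡ (basis-product a v j))) ⟨
      weights (+ v ℤ.+ a′) (suc j) * gaps (+ v) (suc j) + A (+ 2 ℤ.* + v ℤ.+ a) * (⟨ suc j ⟩ * basis a v j)
        ≈⟨ +-congʳ (basis-product a′ v (suc j)) ⟨
      basis a′ v (suc j) + A (+ 2 ℤ.* + v ℤ.+ a) * (⟨ suc j ⟩ * basis a v j) ∎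
      where
      a′ = a ℤ.- + 1
      e  = + v ℤ.+ a
      W  = weights e j
      N  = gaps (+ v) j
      e₁ : + suc v ℤ.+ a′ ≡ e
      e₁ = solveℤ 2 (λ v a → (# (+ 1) ⊹ v) ⊹ (a ∸ # (+ 1)) ≔ v ⊹ a) ≡.refl (+ v) a
      e₂ : + v ℤ.+ a′ ≡ ℤ.-1ℤ ℤ.+ e
      e₂ = solveℤ 2 (λ v a → v ⊹ (a ∸ # (+ 1)) ≔ # ℤ.-1ℤ ⊹ (v ⊹ a)) ≡.refl (+ v) a
      lower : weights (+ v ℤ.+ a′) (suc j) ≈ A (ℤ.-1ℤ ℤ.+ e) * W
      lower = trans (weights-head (+ v ℤ.+ a′) j)
        (*-cong (A-cong e₂) (reflexive (≡.cong (λ e → weights e j)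
          (solveℤ 2 (λ v a → # (+ 1) ⊹ (v ⊹ (a ∸ # (+ 1))) ≔ v ⊹ a) ≡.refl (+ v) a))))
      telescope : A (e ℤ.+ + j) * ⟦ + suc v ⟧
                    ≈ A (ℤ.-1ℤ ℤ.+ e) * ⟦ + v ℤ.- + j ⟧ + A (+ 2 ℤ.* + v ℤ.+ a) * ⟨ suc j ⟩
      telescope = begin
        A (e ℤ.+ + j) * ⟦ + suc v ⟧
          ≈⟨ A*⟦⟧ (e ℤ.+ + j) (+ suc v) ⟩
        Ψ (e ℤ.+ + j ℤ.+ + suc v) - Ψ (e ℤ.+ + j ℤ.- + suc v)
          ≈⟨ +-cong
               (Ψ-cong (solveℤ 3 (λ v a j → v ⊹ a ⊹ j ⊹ (# (+ 1) ⊹ v) ≔ # (+ 2) ⋆ v ⊹ a ⊹ (# (+ 1) ⊹ j))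
                 ≡.refl (+ v) a (+ j)))
               (-‿cong (Ψ-cong (solveℤ 3 (λ v a j → v ⊹ a ⊹ j ∸ (# (+ 1) ⊹ v) ≔ # ℤ.-1ℤ ⊹ (v ⊹ a) ∸ (v ∸ j))
                 ≡.refl (+ v) a (+ j)))) ⟩
        Ψ (+ 2 ℤ.* + v ℤ.+ a ℤ.+ + suc j) - Ψ (ℤ.-1ℤ ℤ.+ e ℤ.- (+ v ℤ.- + j))
          -- The lower end also belongs to the product of A(e-1) and v - j, because e + j - (v+1) =
          -- e - 1 - (v-j). The inserted value is the mirror image of the upper end in 2v + a, which
          -- is where the lozenge weight comes from.
          ≈⟨ solve 3 (λ x y z → x :- y := (z :- y) :+ (x :- z)) refl _ _ (Ψ (+ 2 ℤ.* + v ℤ.+ a ℤ.- + suc j)) ⟩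
        (Ψ (+ 2 ℤ.* + v ℤ.+ a ℤ.- + suc j) - Ψ (ℤ.-1ℤ ℤ.+ e ℤ.- (+ v ℤ.- + j)))
          + (Ψ (+ 2 ℤ.* + v ℤ.+ a ℤ.+ + suc j) - Ψ (+ 2 ℤ.* + v ℤ.+ a ℤ.- + suc j))
          ≈⟨ +-congʳ (+-congʳ
               (Ψ-cong (solveℤ 3 (λ v a j → # (+ 2) ⋆ v ⊹ a ∸ (# (+ 1) ⊹ j) ≔ # ℤ.-1ℤ ⊹ (v ⊹ a) ⊹ (v ∸ j))
                 ≡.refl (+ v) a (+ j)))) ⟩
        (Ψ (ℤ.-1ℤ ℤ.+ e ℤ.+ (+ v ℤ.- + j)) - Ψ (ℤ.-1ℤ ℤ.+ e ℤ.- (+ v ℤ.- + j)))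
          + (Ψ (+ 2 ℤ.* + v ℤ.+ a ℤ.+ + suc j) - Ψ (+ 2 ℤ.* + v ℤ.+ a ℤ.- + suc j))
          ≈⟨ +-cong (A*⟦⟧ (ℤ.-1ℤ ℤ.+ e) (+ v ℤ.- + j)) (A*⟨⟩ (suc j) (+ 2 ℤ.* + v ℤ.+ a)) ⟨
        A (ℤ.-1ℤ ℤ.+ e) * ⟦ + v ℤ.- + j ⟧ + A (+ 2 ℤ.* + v ℤ.+ a) * ⟨ suc j ⟩ ∎

-- Weighted sums over lists of directions.

module TilingSums {c ℓ : Level} (R : CommutativeRing c ℓ) where
  open CommutativeRing R
  open Columns
  open IntegerSolver R using (solve; _:=_; _:+_; _:*_; _:-_; :-_; con)
  open Determinants R
  open QCalculus R
  open import Data.Bool using (Bool; true; false; _∧_; if_then_else_)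
  open import Data.Fin using (Fin; toℕ) renaming (zero to fzero; suc to fsuc)
  open import Data.Fin.Subset using (Subset; ∣_∣)
  open import Data.Fin.Subset.Properties using () renaming (_∈?_ to _∈ˢ?_)
  open import Data.Nat as ℕ using (ℕ; zero; suc)
  import Data.Nat.Properties as ℕP
  open import Data.Integer as ℤ using (ℤ; +_)
  import Data.Integer.Properties as ℤP
  import Data.Integer.Solver as ℤS
  open ℤS.+-*-Solver using ()
    renaming (solve to solveℤ; _:=_ to _≔_; _:+_ to _⊹_; _:*_ to _⋆_; _:-_ to _∸_; con to #_)
  open import Data.List using (List; []; _∷_; _++_; map; length; applyUpTo; take; drop; filter; tabulate)
  open import Data.List.Properties using (map-upTo; map-applyUpTo; map-∘; map-++; length-++; length-map)
  open import Data.List.Relation.Unary.All as All using (All; []; _∷_)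
  open import Data.List.Relation.Unary.AllPairs using (AllPairs; []; _∷_)
  open import Data.Maybe using (just; nothing)
  open import Data.Product using (_×_; _,_; proj₁; proj₂)
  open import Data.Vec using (toList; lookup; []; _∷_)
  open import Data.Vec.Properties using (length-toList)
  open import Function using (_∘_; case_of_)
  open import Relation.Nullary using (Dec; yes; no; does; contradiction)
  open import Relation.Binary.PropositionalEquality as ≡ using (_≡_)
  open import Algebra.Properties.Ring ring
  open import Relation.Binary.Reasoning.Setoid setoid

  -- Branching on the first direction matches the recursion of `accept`: in each state the forbidden
  -- branches become sums of zeros.
  dirSum : ℕ → (List Dir → Carrier) → Carrier
  dirSum zero    f = f []
  dirSum (suc n) f = dirSum n (f ∘ (hor ∷_)) + (dirSum n (f ∘ (down ∷_)) + dirSum n (f ∘ (up ∷_)))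

  sumR-++ : ∀ as bs → sumR R (as ++ bs) ≈ sumR R as + sumR R bs
  sumR-++ []       bs = sym (+-identityˡ _)
  sumR-++ (a ∷ as) bs = trans (+-congˡ (sumR-++ as bs)) (sym (+-assoc _ _ _))

  sum-allDirs : ∀ n f → sumR R (map f (allDirs n)) ≈ dirSum n f
  sum-allDirs zero    f = +-identityʳ _
  sum-allDirs (suc n) f = trans (block hor _) (+-cong (by-dir hor)
    (trans (block down _) (+-cong (by-dir down) (trans (block up _) (trans (+-identityʳ _) (by-dir up))))))
    where
    by-dir : ∀ d → sumR R (map f (map (d ∷_) (allDirs n))) ≈ dirSum n (f ∘ (d ∷_))
    by-dir d = trans (reflexive (≡.cong (sumR R) (≡.sym (map-∘ (allDirs n))))) (sum-allDirs n (f ∘ (d ∷_)))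
    block : ∀ d rest → sumR R (map f (map (d ∷_) (allDirs n) ++ rest))
                         ≈ sumR R (map f (map (d ∷_) (allDirs n))) + sumR R (map f rest)
    block d rest = trans (reflexive (≡.cong (sumR R) (map-++ f (map (d ∷_) (allDirs n)) rest)))
                         (sumR-++ (map f (map (d ∷_) (allDirs n))) (map f rest))

  dirSum-cong : ∀ n {f g} → (∀ ds → length ds ≡ n → f ds ≈ g ds) → dirSum n f ≈ dirSum n g
  dirSum-cong zero    f≈g = f≈g [] ≡.refl
  dirSum-cong (suc n) f≈g = +-cong (with-dir hor) (+-cong (with-dir down) (with-dir up))
    where with-dir = λ d → dirSum-cong n (λ ds len≡n → f≈g (d ∷ ds) (≡.cong suc len≡n))

  dirSum-zero : ∀ n → dirSum n (λ _ → 0#) ≈ 0#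
  dirSum-zero zero    = refl
  dirSum-zero (suc n) = trans (+-cong (dirSum-zero n) (+-cong (dirSum-zero n) (dirSum-zero n)))
                              (trans (+-identityˡ _) (+-identityˡ _))

  dirSum-scale : ∀ n a f → dirSum n (λ ds → a * f ds) ≈ a * dirSum n f
  dirSum-scale zero    a f = refl
  dirSum-scale (suc n) a f =
    trans (+-cong (dirSum-scale n a _) (+-cong (dirSum-scale n a _) (dirSum-scale n a _)))
          (solve 4 (λ a x y z → a :* x :+ (a :* y :+ a :* z) := a :* (x :+ (y :+ z))) refl a _ _ _)

  dirSum-+ : ∀ n f g → dirSum n (λ ds → f ds + g ds) ≈ dirSum n f + dirSum n g
  dirSum-+ zero    f g = refl
  dirSum-+ (suc n) f g =
    trans (+-cong (dirSum-+ n _ _) (+-cong (dirSum-+ n _ _) (dirSum-+ n _ _)))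
          (solve 6 (λ a b c x y z → (a :+ x) :+ ((b :+ y) :+ (c :+ z)) := (a :+ (b :+ c)) :+ (x :+ (y :+ z)))
                   refl _ _ _ _ _ _)

  dirSum-split : ∀ m n f → dirSum (m ℕ.+ n) f ≈ dirSum m (λ ds → dirSum n (λ es → f (ds ++ es)))
  dirSum-split zero    n f = refl
  dirSum-split (suc m) n f =
    +-cong (dirSum-split m n _) (+-cong (dirSum-split m n _) (dirSum-split m n _))

  dirSum-comm : ∀ m n (f : List Dir → List Dir → Carrier) →
                dirSum m (λ ds → dirSum n (f ds)) ≈ dirSum n (λ es → dirSum m (λ ds → f ds es))
  dirSum-comm zero    n f = refl
  dirSum-comm (suc m) n f = begin
    dirSum m (λ ds → dirSum n (f (hor ∷ ds)))
      + (dirSum m (λ ds → dirSum n (f (down ∷ ds))) + dirSum m (λ ds → dirSum n (f (up ∷ ds))))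
      ≈⟨ +-cong (dirSum-comm m n _) (+-cong (dirSum-comm m n _) (dirSum-comm m n _)) ⟩
    dirSum n (g hor) + (dirSum n (g down) + dirSum n (g up))
      ≈⟨ trans (dirSum-+ n (g hor) _) (+-congˡ (dirSum-+ n (g down) (g up))) ⟨
    dirSum n (λ es → g hor es + (g down es + g up es)) ∎
    where g = λ d es → dirSum m (λ ds → f (d ∷ ds) es)

  infix 5 _▸_
  _▸_ : Bool → Carrier → Carrier
  b ▸ a = if b then a else 0#

  ▸-cong : ∀ b {x y} → x ≈ y → b ▸ x ≈ b ▸ y
  ▸-cong true  x≈y = x≈y
  ▸-cong false x≈y = refl

  ▸-scale : ∀ b a x → (b ▸ a * x) ≈ a * (b ▸ x)
  ▸-scale true  a x = refl
  ▸-scale false a x = sym (zeroʳ a)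

  ▸-∧ : ∀ b t {a u v} → u ≈ a * v → (b ∧ t ▸ u) ≈ (b ▸ a * (t ▸ v))
  ▸-∧ true  true  u≈av = u≈av
  ▸-∧ true  false u≈av = sym (zeroʳ _)
  ▸-∧ false t     u≈av = refl

  does-≡ : ∀ {p} {P : Set p} (P? : Dec P) {b} → (P → b ≡ true) → (b ≡ true → P) → does P? ≡ b
  does-≡ (yes p) to from = ≡.sym (to p)
  does-≡ (no ¬p) {true}  to from = contradiction (from ≡.refl) ¬p
  does-≡ (no ¬p) {false} to from = ≡.refl

  -- Summation over a single column.

  positions : ℕ → List Bool → List ℕ
  positions s []           = []
  positions s (true  ∷ bs) = s ∷ positions (suc s) bs
  positions s (false ∷ bs) = positions (suc s) bs

  -- The sum over all completions of a column from height s upwards: if cov holds, the next horizontal lozenge may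
  -- lie anywhere between s and the next marked position, and P telescopes over this range.
  interlaced : (ℕ → Row) → Bool → ℕ → List ℕ → (List Row → Carrier) → Carrier
  interlaced P true  s vs       F = F (differences (P s) (map P vs))
  interlaced P false s []       F = 0#
  interlaced P false s (v ∷ vs) F = F (differences (P v) (map P vs))

  module Column (weight : ℕ → Carrier) (p P : ℕ → Row)
                (P-step : ∀ s j → P (suc s) j ≈ P s j + weight s * p s j) where

    cellWeight : ℕ → Dir → Carrier
    cellWeight s hor  = weight s
    cellWeight s down = 1#
    cellWeight s up   = 1#

    columnWeight : ℕ → List Dir → Carrier
    columnWeight s []       = 1#
    columnWeight s (d ∷ ds) = cellWeight s d * columnWeight (suc s) ds

    columnSum : Bool → ℕ → List Bool → (List Row → Carrier) → ℕ → Carrier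
    columnSum cov s bs F n = dirSum n λ ds →
      accept cov bs ds ▸ columnWeight s ds * F (map p (positions s (hors ds)))

    -- The next horizontal lozenge lies on segment `s` or higher up. The two choices differ in one
    -- row only, and there `P-step` extends the range of the telescoping sum down to `s`.
    interlaced-step : ∀ {F} → Multilinear F → ∀ s vs →
      interlaced P false (suc s) vs (F ∘ ((weight s ⊙ p s) ∷_)) + interlaced P true (suc s) vs F
        ≈ F (differences (P s) (map P vs))
    interlaced-step ml s []       = +-identityˡ _
    interlaced-step {F} ml s (v ∷ vs) = begin
      F ((weight s ⊙ p s) ∷ D) + F ((P v ⊝ P (suc s)) ∷ D)
        ≈⟨ Linear.head-⊕ ml _ _ D ⟨
      F (((weight s ⊙ p s) ⊕ (P v ⊝ P (suc s))) ∷ D)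
        ≈⟨ Linear.head-cong ml D (λ j → trans (+-congˡ (+-congˡ (-‿cong (P-step s j))))
             (solve 3 (λ a b c → a :+ (b :- (c :+ a)) := b :- c) refl _ _ _)) ⟩
      F ((P v ⊝ P s) ∷ D) ∎
      where D = differences (P v) (map P vs)

    columnSum-hor : ∀ {F} → Multilinear F → ∀ s bs n →
      dirSum n (λ ds → accept false bs ds ▸ columnWeight s (hor ∷ ds) * F (p s ∷ map p (positions (suc s) (hors ds))))
        ≈ columnSum false (suc s) bs (F ∘ ((weight s ⊙ p s) ∷_)) n
    columnSum-hor {F} ml s bs n = dirSum-cong n λ ds _ → ▸-cong (accept false bs ds)
      (trans (solve 3 (λ a b c → (a :* b) :* c := b :* (a :* c)) refl (weight s) _ _)
             (*-congˡ (sym (Linear.head-⊙ ml (weight s) (p s) _))))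

    columnSum-slant : ∀ F cov s bs n →
      dirSum n (λ ds → accept cov bs ds ▸ (1# * columnWeight (suc s) ds) * F (map p (positions (suc s) (hors ds))))
        ≈ columnSum cov (suc s) bs F n
    columnSum-slant F cov s bs n =
      dirSum-cong n λ ds _ → ▸-cong (accept cov bs ds) (*-congʳ (*-identityˡ _))

    -- Common to both states in which triangle `s` is already settled, covered from below or marked:
    -- going down is blocked, and the right-pointing triangle is horizontal or goes up.
    columnSum-choice : ∀ {F} → Multilinear F → ∀ s bs n → let vs = positions (suc s) bs in
      columnSum false (suc s) bs (F ∘ ((weight s ⊙ p s) ∷_)) n
        ≈ interlaced P false (suc s) vs (F ∘ ((weight s ⊙ p s) ∷_)) →
      columnSum true (suc s) bs F n ≈ interlaced P true (suc s) vs F →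
      dirSum n (λ ds → accept false bs ds ▸ columnWeight s (hor ∷ ds) * F (p s ∷ map p (positions (suc s) (hors ds))))
        + (dirSum n (λ _ → 0#)
        + dirSum n (λ ds → accept true bs ds ▸ columnWeight s (up ∷ ds) * F (map p (positions (suc s) (hors ds)))))
        ≈ F (differences (P s) (map P vs))
    columnSum-choice {F} ml s bs n after-hor after-up = trans
      (+-cong (trans (columnSum-hor ml s bs n) after-hor)
              (trans (+-congʳ (dirSum-zero n)) (trans (+-identityˡ _)
                (trans (columnSum-slant F true s bs n) after-up))))
      (interlaced-step ml s (positions (suc s) bs))

    -- A horizontal lozenge at `s` adds a row in front of all later ones. It is absorbed into the
    -- function, so the induction needs every multilinear `F`, not just a determinant.
    columnSum-interlaced : ∀ {F} → Multilinear F → ∀ n cov s bs → length bs ≡ suc n →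
                           columnSum cov s bs F n ≈ interlaced P cov s (positions s bs) F
    -- A triangle both covered and marked admits no completion; on the other side the first row is
    -- the empty range `P s ⊝ P s`.
    columnSum-interlaced ml zero    true  s (true ∷ [])  _ =
      sym (Linear.head-zero ml (P s ⊝ P s) [] (λ j → -‿inverseʳ _))
    columnSum-interlaced ml zero    true  s (false ∷ []) _ = *-identityˡ _
    columnSum-interlaced ml zero    false s (true ∷ [])  _ = *-identityˡ _
    -- The topmost left-pointing triangle has no right-pointing one beside it to come down, so it
    -- stays uncovered.
    columnSum-interlaced ml zero    false s (false ∷ []) _ = refl
    columnSum-interlaced {F} ml (suc n) true  s (true ∷ bs)  len≡ = begin
      dirSum n (λ _ → 0#) + (dirSum n (λ _ → 0#) + dirSum n (λ _ → 0#)) ≈⟨ dirSum-zero (suc n) ⟩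
      0# ≈⟨ Linear.head-zero ml (P s ⊝ P s) _ (λ j → -‿inverseʳ _) ⟨
      interlaced P true s (s ∷ positions (suc s) bs) F ∎
    columnSum-interlaced ml (suc n) true  s (false ∷ bs) len≡ = columnSum-choice ml s bs n
      (columnSum-interlaced (fix-row _ ml) n false (suc s) bs (ℕP.suc-injective len≡))
      (columnSum-interlaced ml n true (suc s) bs (ℕP.suc-injective len≡))
    columnSum-interlaced ml (suc n) false s (true ∷ bs)  len≡ = columnSum-choice ml s bs n
      (columnSum-interlaced (fix-row _ ml) n false (suc s) bs (ℕP.suc-injective len≡))
      (columnSum-interlaced ml n true (suc s) bs (ℕP.suc-injective len≡))
    columnSum-interlaced {F} ml (suc n) false s (false ∷ bs) len≡ =
      trans (+-cong (dirSum-zero n) (+-cong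
              (trans (columnSum-slant F false s bs n)
                     (columnSum-interlaced ml n false (suc s) bs (ℕP.suc-injective len≡)))
              (dirSum-zero n)))
            (trans (+-identityˡ _) (trans (+-identityʳ _) (restart (positions (suc s) bs))))
      where
      restart : ∀ vs → interlaced P false (suc s) vs F ≈ interlaced P false s vs F
      restart []      = refl
      restart (_ ∷ _) = refl

  map-shift-differences : ∀ r rs → map (_∘ suc) (differences r rs) ≡ differences (r ∘ suc) (map (_∘ suc) rs)
  map-shift-differences r []       = ≡.refl
  map-shift-differences r (s ∷ rs) = ≡.cong (((s ⊝ r) ∘ suc) ∷_) (map-shift-differences s rs)

  prodUpTo-last : ∀ f n → prod R (applyUpTo f (suc n)) ≈ prod R (applyUpTo f n) * f n
  prodUpTo-last f zero    = *-comm _ _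
  prodUpTo-last f (suc n) = trans (*-congˡ (prodUpTo-last (f ∘ suc) n)) (sym (*-assoc _ _ _))

  columnProduct-upTo : ∀ γ n j f → (∀ i → f i ≡ γ (j ℕ.+ i)) → columnProduct γ n j ≈ prod R (applyUpTo f n)
  columnProduct-upTo γ zero    j f f≡ = refl
  columnProduct-upTo γ (suc n) j f f≡ = *-cong
    (reflexive (≡.sym (≡.trans (f≡ 0) (≡.cong γ (ℕP.+-identityʳ j)))))
    (columnProduct-upTo γ n (suc j) (f ∘ suc) (λ i → ≡.trans (f≡ (suc i)) (≡.cong γ (ℕP.+-suc j i))))

  prod-++ : ∀ as bs → prod R (as ++ bs) ≈ prod R as * prod R bs
  prod-++ []       bs = sym (*-identityˡ _)
  prod-++ (a ∷ as) bs = trans (*-congˡ (prod-++ as bs)) (sym (*-assoc _ _ _))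

  take-length-++ : ∀ {n} (ds es : List Dir) → length ds ≡ n → take n (ds ++ es) ≡ ds
  take-length-++ []       es ≡.refl = ≡.refl
  take-length-++ (d ∷ ds) es ≡.refl = ≡.cong (d ∷_) (take-length-++ ds es ≡.refl)

  drop-length-++ : ∀ {n} (ds es : List Dir) → length ds ≡ n → drop n (ds ++ es) ≡ es
  drop-length-++ []       es ≡.refl = ≡.refl
  drop-length-++ (d ∷ ds) es ≡.refl = drop-length-++ ds es ≡.refl

  positions-above : ∀ s bs → All (s ℕ.≤_) (positions s bs)
  positions-above s []           = []
  positions-above s (true ∷ bs)  = ℕP.≤-refl ∷ All.map ℕP.<⇒≤ (positions-above (suc s) bs)
  positions-above s (false ∷ bs) = All.map ℕP.<⇒≤ (positions-above (suc s) bs)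

  positions-sorted : ∀ s bs → AllPairs ℕ._<_ (positions s bs)
  positions-sorted s []           = []
  positions-sorted s (true ∷ bs)  = positions-above (suc s) bs ∷ positions-sorted (suc s) bs
  positions-sorted s (false ∷ bs) = positions-sorted (suc s) bs

  length-positions : ∀ s bs → length (positions s bs) ≡ ones bs
  length-positions s []           = ≡.refl
  length-positions s (true ∷ bs)  = ≡.cong suc (length-positions (suc s) bs)
  length-positions s (false ∷ bs) = length-positions (suc s) bs

  elems-positions : ∀ {m} (W : Subset m) → elems R W ≡ map suc (positions 0 (toList W))
  elems-positions {m} W = go m W (λ i → i) 0 (λ i → does-lookup W i) (λ _ → ≡.refl)
    where
    does-lookup : ∀ {m} (W : Subset m) i → does (i ∈ˢ? W) ≡ lookup W i
    does-lookup (true  ∷ W) fzero    = ≡.refl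
    does-lookup (false ∷ W) fzero    = ≡.refl
    does-lookup (_     ∷ W) (fsuc i) = does-lookup W i
    -- `g` embeds the indices of the unread suffix `V` into those of `W`, because the filter keeps
    -- testing membership in all of `W`.
    go : ∀ n (V : Subset n) (g : Fin n → Fin m) s → (∀ i → does (g i ∈ˢ? W) ≡ lookup V i) →
         (∀ i → toℕ (g i) ≡ s ℕ.+ toℕ i) →
         map (λ i → suc (toℕ i)) (filter (_∈ˢ? W) (tabulate g)) ≡ map suc (positions s (toList V))
    go zero    []      g s member height = ≡.refl
    go (suc n) (b ∷ V) g s member height with does (g fzero ∈ˢ? W) | member fzero
    ... | true  | ≡.refl = ≡.cong₂ _∷_ (≡.cong suc (≡.trans (height fzero) (ℕP.+-identityʳ s)))
            (go n V (g ∘ fsuc) (suc s) (member ∘ fsuc) (λ i → ≡.trans (height (fsuc i)) (ℕP.+-suc s _)))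
    ... | false | ≡.refl =
            go n V (g ∘ fsuc) (suc s) (member ∘ fsuc) (λ i → ≡.trans (height (fsuc i)) (ℕP.+-suc s _))

  vandermonde-pairs : ∀ (f : ℕ → Carrier) (g : ℕ × ℕ → Carrier) →
    (∀ {v v′} → v ℕ.< v′ → g (suc v , suc v′) ≈ f v′ - f v) →
    ∀ {vs} → AllPairs ℕ._<_ vs → vandermonde (map f vs) ≈ prod R (map g (pairsOf R (map suc vs)))
  vandermonde-pairs f g g≈ []                  = refl
  vandermonde-pairs f g g≈ {v ∷ vs} (v< ∷ sorted) = begin
    prod R (map (_- f v) (map f vs)) * vandermonde (map f vs)
      ≈⟨ *-cong (factors v<) (vandermonde-pairs f g g≈ sorted) ⟩
    prod R (map g (map (suc v ,_) (map suc vs))) * prod R (map g (pairsOf R (map suc vs)))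
      ≈⟨ prod-++ (map g (map (suc v ,_) (map suc vs))) _ ⟨
    prod R (map g (map (suc v ,_) (map suc vs)) ++ map g (pairsOf R (map suc vs)))
      ≈⟨ reflexive (≡.cong (prod R) (map-++ g (map (suc v ,_) (map suc vs)) _)) ⟨
    prod R (map g (pairsOf R (suc v ∷ map suc vs))) ∎
    where
    factors : ∀ {vs} → All (v ℕ.<_) vs →
              prod R (map (_- f v) (map f vs)) ≈ prod R (map g (map (suc v ,_) (map suc vs)))
    factors []          = refl
    factors (v<v′ ∷ rest) = *-cong (sym (g≈ v<v′)) (factors rest)

  -- Induction over the lattice lines.

  module Tilings (q qi h X Y : Carrier) (q*qi≈1 : q * qi ≈ 1#) (k : ℤ) (x : ℕ) where
    open QIntegers q qi h X Y q*qi≈1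

    -- A horizontal lozenge across segment s of line y has i-coordinate 2 s + level y.
    level : ℕ → ℤ
    level y = k ℤ.+ + 1 ℤ.- + x ℤ.- + y

    level-suc : ∀ y → level (suc y) ≡ level y ℤ.- + 1
    level-suc y =
      solveℤ 3 (λ k x y → k ⊹ # (+ 1) ∸ x ∸ (# (+ 1) ⊹ y) ≔ k ⊹ # (+ 1) ∸ x ∸ y ∸ # (+ 1)) ≡.refl k (+ x) (+ y)

    lineWeight : ℕ → ℕ → Carrier
    lineWeight y s = A (+ 2 ℤ.* + s ℤ.+ level y)

    -- The constants of `basis-step`, kept with the functions of the lower line because they cannot
    -- be divided out of the upper one.
    γ : ℕ → Carrier
    γ j = ⟨ suc j ⟩

    module Line (y : ℕ) where
      open Column (lineWeight y)
                  (λ v → scaleColumns γ (basis (level y) v))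
                  -- The constant function is left out: its differences vanish, and y differences of
                  -- y + 1 rows need just the degrees 1 to y.
                  (λ v → basis (level (suc y)) v ∘ suc)
                  (λ s j → ≡.subst (λ a′ → basis a′ (suc s) (suc j)
                       ≈ basis a′ s (suc j) + lineWeight y s * (γ j * basis (level y) s j))
                     (≡.sym (level-suc y)) (basis-step (level y) s j)) public

    W : List Cell → List Dir → Carrier
    W = weightOf R q qi h X Y k x

    W-++ : ∀ rs {rs′} ds {es} → length ds ≡ length rs → W (rs ++ rs′) (ds ++ es) ≈ W rs ds * W rs′ es
    W-++ []       []       _    = sym (*-identityˡ _)
    W-++ (r ∷ rs) (d ∷ ds) len≡ =
      trans (*-congˡ (W-++ rs ds (ℕP.suc-injective len≡))) (sym (*-assoc _ _ _))

    W-segs : ∀ y s m ds → length ds ≡ m → W (segs y s m) ds ≈ Line.columnWeight y s ds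
    W-segs y s zero    []       _    = refl
    W-segs y s (suc m) (d ∷ ds) len≡ = *-cong (cell d) (W-segs y (suc s) m ds (ℕP.suc-injective len≡))
      where
      index : k ℤ.+ + (2 ℕ.* s ℕ.+ 1) ℤ.- + x ℤ.- + y ≡ + 2 ℤ.* + s ℤ.+ level y
      index = ≡.trans
        (≡.cong (λ z → k ℤ.+ z ℤ.- + x ℤ.- + y)
          (≡.trans (ℤP.pos-+ (2 ℕ.* s) 1) (≡.cong (ℤ._+ + 1) (ℤP.pos-* 2 s))))
        (solveℤ 4 (λ k s x y → k ⊹ (# (+ 2) ⋆ s ⊹ # (+ 1)) ∸ x ∸ y ≔ # (+ 2) ⋆ s ⊹ (k ⊹ # (+ 1) ∸ x ∸ y))
          ≡.refl k (+ s) (+ x) (+ y))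
      cell : ∀ d → lozW R q qi h X Y k x (y , s) d ≈ Line.cellWeight y s d
      cell hor  = A-cong index
      cell down = refl
      cell up   = refl

    tilingSum : ℕ → List Bool → Carrier
    tilingSum y w = dirSum (length (RTris x y)) (λ ch → tiled x y w ch ▸ W (RTris x y) ch)

    tiled-++ : ∀ y w ds es → length ds ≡ length (RTris x y) →
               tiled x (suc y) w (ds ++ es) ≡ accept false w es ∧ tiled x y (hors es) ds
    tiled-++ y w ds es ds≡ = ≡.cong₂ (λ ds es → accept false w es ∧ tiled x y (hors es) ds)
      (take-length-++ ds es ds≡) (drop-length-++ ds es ds≡)

    -- The sums are exchanged so that the last column is outermost: its horizontal lozenges are the
    -- boundary data on which the inner sum depends.
    join-columns : ∀ rs₁ rs₂ n (b : List Dir → Bool) (acc : List Dir → Bool) (t : List Dir → List Dir → Bool)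
      (cw : List Dir → Carrier) → length rs₂ ≡ n →
      (∀ ds es → length ds ≡ length rs₁ → b (ds ++ es) ≡ acc es ∧ t es ds) →
      (∀ es → length es ≡ n → W rs₂ es ≈ cw es) →
      dirSum (length (rs₁ ++ rs₂)) (λ ch → b ch ▸ W (rs₁ ++ rs₂) ch)
        ≈ dirSum n (λ es → acc es ▸ cw es * dirSum (length rs₁) (λ ds → t es ds ▸ W rs₁ ds))
    join-columns rs₁ rs₂ n b acc t cw ≡.refl b≡ W≈ = begin
      dirSum (length (rs₁ ++ rs₂)) term
        ≡⟨ ≡.cong (λ m → dirSum m term) (length-++ rs₁) ⟩
      dirSum (length rs₁ ℕ.+ n) term
        ≈⟨ dirSum-split (length rs₁) n term ⟩
      dirSum (length rs₁) (λ ds → dirSum n (λ es → term (ds ++ es)))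
        ≈⟨ dirSum-cong (length rs₁) (λ ds ds≡ → dirSum-cong n (λ es es≡ → factor ds es ds≡ es≡)) ⟩
      dirSum (length rs₁) (λ ds → dirSum n (λ es → acc es ▸ cw es * (t es ds ▸ W rs₁ ds)))
        ≈⟨ dirSum-comm (length rs₁) n _ ⟩
      dirSum n (λ es → dirSum (length rs₁) (λ ds → acc es ▸ cw es * (t es ds ▸ W rs₁ ds)))
        ≈⟨ dirSum-cong n (λ es _ → pull (acc es) (cw es) _) ⟩
      dirSum n (λ es → acc es ▸ cw es * dirSum (length rs₁) (λ ds → t es ds ▸ W rs₁ ds)) ∎
      where
      term : List Dir → Carrier
      term ch = b ch ▸ W (rs₁ ++ rs₂) ch
      factor : ∀ ds es → length ds ≡ length rs₁ → length es ≡ n →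
               term (ds ++ es) ≈ (acc es ▸ cw es * (t es ds ▸ W rs₁ ds))
      factor ds es ds≡ es≡ =
        trans (reflexive (≡.cong (_▸ W (rs₁ ++ rs₂) (ds ++ es)) (b≡ ds es ds≡)))
              (▸-∧ (acc es) (t es ds) (trans (W-++ rs₁ ds ds≡) (trans (*-comm _ _) (*-congʳ (W≈ es es≡)))))
      pull : ∀ b a (f : List Dir → Carrier) →
             dirSum (length rs₁) (λ ds → b ▸ a * f ds) ≈ (b ▸ a * dirSum (length rs₁) f)
      pull true  a f = dirSum-scale (length rs₁) a f
      pull false a f = dirSum-zero (length rs₁)

    tilingSum-suc : ∀ y w → tilingSum (suc y) w
      ≈ dirSum (x ℕ.+ y) (λ ds → accept false w ds ▸ Line.columnWeight y 0 ds * tilingSum y (hors ds))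
    tilingSum-suc y w = trans
      (reflexive (≡.cong (λ rs → dirSum (length rs) (λ ch → tiled x (suc y) w ch ▸ W rs ch)) (RTris-suc x y)))
      (join-columns (RTris x y) (segs y 0 (x ℕ.+ y)) (x ℕ.+ y) (tiled x (suc y) w) (accept false w)
        (λ es ds → tiled x y (hors es) ds) (Line.columnWeight y 0) (length-segs y 0 (x ℕ.+ y))
        (tiled-++ y w) (W-segs y 0 (x ℕ.+ y)))

    denom-suc : ∀ y → denom R q qi (suc y) ≈ denom R q qi y * qfact R q qi y
    denom-suc zero    = sym (*-identityˡ _)
    denom-suc (suc n) = begin
      prod R (map (qfact R q qi) (applyUpTo suc (suc n)))
        ≡⟨ ≡.cong (prod R) (map-applyUpTo suc (qfact R q qi) (suc n)) ⟩
      prod R (applyUpTo (qfact R q qi ∘ suc) (suc n))            ≈⟨ prodUpTo-last _ n ⟩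
      prod R (applyUpTo (qfact R q qi ∘ suc) n) * qfact R q qi (suc n)
        ≡⟨ ≡.cong (λ ps → prod R ps * qfact R q qi (suc n)) (map-applyUpTo suc (qfact R q qi) n) ⟨
      denom R q qi (suc n) * qfact R q qi (suc n) ∎

    columnProduct-qfact : ∀ y → columnProduct γ y 0 ≈ qfact R q qi y
    columnProduct-qfact y = trans (columnProduct-upTo γ y 0 γ (λ _ → ≡.refl))
                                  (reflexive (≡.cong (prod R) (≡.sym (map-upTo γ y))))

    -- Subtracting adjacent rows leaves a single 1 in the constant column, which lowers the size of
    -- the determinant by one.
    det-interlaced : ∀ y a vs → interlaced (λ v → basis a v ∘ suc) false 0 vs (det y 0)
                                  ≈ det (suc y) 0 (map (basis a) vs)
    det-interlaced y a []       = refl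
    det-interlaced y a (v ∷ vs) = sym (begin
      det (suc y) 0 (r ∷ map (basis a) vs)
        ≈⟨ subtract-previous (det-multilinear (suc y) 0) (det-alternating (suc y) 0) r _ ⟩
      det (suc y) 0 (r ∷ differences r (map (basis a) vs))
        ≈⟨ det-unit-column y r _ refl (unit v vs) ⟩
      det y 0 (map (_∘ suc) (differences r (map (basis a) vs)))
        ≡⟨ ≡.cong (det y 0) (≡.trans (map-shift-differences r (map (basis a) vs))
             (≡.cong (differences (r ∘ suc)) (≡.sym (map-∘ vs)))) ⟩
      det y 0 (differences (r ∘ suc) (map (λ v → basis a v ∘ suc) vs)) ∎)
      where
      r = basis a v
      unit : ∀ v vs → All (λ s → s 0 ≈ 0#) (differences (basis a v) (map (basis a) vs))
      unit v []        = []
      unit v (v′ ∷ vs) = -‿inverseʳ 1# ∷ unit v′ vs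

    -- The number of marks is left free because the induction hypothesis is applied to the
    -- horizontal lozenges of every `ds`. With a wrong number both sides vanish, the determinant for
    -- having the wrong number of rows.
    tilingSum-det : ∀ y w → length w ≡ x ℕ.+ y →
      tilingSum y w * denom R q qi y ≈ det y 0 (map (basis (level y)) (positions 0 w))
    tilingSum-det zero    w _    = trans (*-identityʳ _) (empty 0 w)
      where
      empty : ∀ s w → (none w ▸ 1#) ≈ det 0 0 (map (basis (level 0)) (positions s w))
      empty s []          = refl
      empty s (true ∷ w)  = refl
      empty s (false ∷ w) = empty (suc s) w
    tilingSum-det (suc y) w len≡ = begin
      tilingSum (suc y) w * denom R q qi (suc y)
        ≈⟨ *-comm _ _ ⟩
      denom R q qi (suc y) * tilingSum (suc y) w
        ≈⟨ *-congˡ (tilingSum-suc y w) ⟩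
      denom R q qi (suc y) * dirSum (x ℕ.+ y) (λ ds → accept false w ds ▸ columnWeight 0 ds * tilingSum y (hors ds))
        ≈⟨ dirSum-scale (x ℕ.+ y) _ _ ⟨
      dirSum (x ℕ.+ y) (λ ds → denom R q qi (suc y) * (accept false w ds ▸ columnWeight 0 ds * tilingSum y (hors ds)))
        ≈⟨ dirSum-cong (x ℕ.+ y) (λ ds ds≡ → trans (sym (▸-scale (accept false w ds) _ _))
             (▸-cong (accept false w ds) (trans (solve 3 (λ d c t → d :* (c :* t) := c :* (t :* d)) refl _ _ _)
                                                (*-congˡ (induct ds ds≡))))) ⟩
      columnSum false 0 w (det y 0) (x ℕ.+ y)
        ≈⟨ columnSum-interlaced (det-multilinear y 0) (x ℕ.+ y) false 0 w (≡.trans len≡ (ℕP.+-suc x y)) ⟩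
      interlaced (λ v → basis (level (suc y)) v ∘ suc) false 0 (positions 0 w) (det y 0)
        ≈⟨ det-interlaced y (level (suc y)) (positions 0 w) ⟩
      det (suc y) 0 (map (basis (level (suc y))) (positions 0 w)) ∎
      where
      open Line y
      induct : ∀ ds → length ds ≡ x ℕ.+ y → tilingSum y (hors ds) * denom R q qi (suc y)
        ≈ det y 0 (map (λ v → scaleColumns γ (basis (level y) v)) (positions 0 (hors ds)))
      induct ds ds≡ = begin
        tilingSum y (hors ds) * denom R q qi (suc y)
          ≈⟨ *-congˡ (denom-suc y) ⟩
        tilingSum y (hors ds) * (denom R q qi y * qfact R q qi y)
          ≈⟨ solve 3 (λ t d f → t :* (d :* f) := f :* (t :* d)) refl _ _ _ ⟩
        qfact R q qi y * (tilingSum y (hors ds) * denom R q qi y)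
          ≈⟨ *-cong (sym (columnProduct-qfact y)) (tilingSum-det y (hors ds) (≡.trans (length-map isHor ds) ds≡)) ⟩
        columnProduct γ y 0 * det y 0 (map (basis (level y)) (positions 0 (hors ds)))
          ≈⟨ det-scale γ y 0 _ ⟨
        det y 0 (map (scaleColumns γ) (map (basis (level y)) (positions 0 (hors ds))))
          ≡⟨ ≡.cong (det y 0) (map-∘ (positions 0 (hors ds))) ⟨
        det y 0 (map (λ v → scaleColumns γ (basis (level y) v)) (positions 0 (hors ds))) ∎

    tilingTerm-tiled : ∀ y (V : Subset (x ℕ.+ suc y)) ch →
      tilingTerm R q qi h X Y k x (suc y) V ch ≡ (tiled x (suc y) (toList V) ch ▸ W (RTris x (suc y)) ch)
    tilingTerm-tiled y V ch with partners (RTris x (suc y)) ch in eq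
    ... | nothing with tiled x (suc y) (toList V) ch in t
    ...   | false = ≡.refl
    -- An accepted list of directions always has partners, so this case contradicts `eq`.
    ...   | true  = case ≡.trans (≡.sym eq) (proj₁ (proj₂ (tiled⇒Tiled x y (toList V) ch (length-toList V) t))) of λ ()
    tilingTerm-tiled y V ch | just ps = ≡.cong (_▸ W (RTris x (suc y)) ch)
      (does-≡ (goodPairing? (LTris x (suc y) V) ps) (proj₁ (good⇔tiled x y V ch eq)) (proj₂ (good⇔tiled x y V ch eq)))

    M-tilingSum : ∀ y (V : Subset (x ℕ.+ y)) → ∣ V ∣ ≡ y → M R q qi h X Y k x y V ≈ tilingSum y (toList V)
    -- The empty region has one tiling, of weight 1, whatever `V` is, whereas `tilingSum` also
    -- checks that there are no marks; the cardinality reconciles the two.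
    M-tilingSum zero    V ∣V∣≡ = trans (+-identityʳ _) (empty (toList V) (≡.trans (ones-toList V) ∣V∣≡))
      where
      empty : ∀ w → ones w ≡ 0 → 1# ≈ (none w ▸ 1#)
      empty []          _  = refl
      empty (false ∷ w) eq = empty w eq
    M-tilingSum (suc y) V _ = trans (sum-allDirs (len (RTris x (suc y))) _)
      (dirSum-cong (len (RTris x (suc y))) (λ ch _ → reflexive (tilingTerm-tiled y V ch)))

    det-Δ : ∀ y (V : Subset (x ℕ.+ y)) → ∣ V ∣ ≡ y →
            det y 0 (map (basis (level y)) (positions 0 (toList V))) ≈ Δ R q qi h X Y k x y V
    det-Δ y V ∣V∣≡ = begin
      det y 0 (map (basis a) vs)
        ≡⟨ ≡.cong₂ (λ n → det n 0) (≡.sym length≡) (map-∘ vs) ⟩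
      det (length zs) 0 (map (newton (node a) (λ _ → 0#)) zs)
        ≈⟨ det-newton (node a) (λ _ → 0#) zs ⟩
      vandermonde zs
        ≈⟨ vandermonde-pairs (node a) _ pair-weight (positions-sorted 0 (toList V)) ⟩
      prod R (map _ (pairsOf R (map suc vs)))
        ≡⟨ ≡.cong (λ es → prod R (map _ (pairsOf R es))) (elems-positions V) ⟨
      Δ R q qi h X Y k x y V ∎
      where
      a  = level y
      vs = positions 0 (toList V)
      zs = map (node a) vs
      length≡ : length zs ≡ y
      length≡ = ≡.trans (length-map (node a) vs)
        (≡.trans (length-positions 0 (toList V)) (≡.trans (ones-toList V) ∣V∣≡))
      pair-weight : ∀ {v v′} → v ℕ.< v′ →
        hw R q qi h X Y (+ (suc v ℕ.+ suc v′) ℤ.+ k ℤ.- + (x ℕ.+ y ℕ.+ 1)) * qint R q qi (suc v′ ℕ.∸ suc v)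
          ≈ node a v′ - node a v
      pair-weight {v} {v′} v<v′ = sym (trans (node-difference a v′ v)
        (*-cong (A-cong index) (reflexive (≡.cong ⟦_⟧ (≡.trans (ℤP.m-n≡m⊖n v′ v) (ℤP.⊖-≥ (ℕP.<⇒≤ v<v′)))))))
        where
        -- Positions are 0-based and labels 1-based. Of the surplus 2, one unit cancels against
        -- `x + y + 1` and the other is the `+ 1` in `level`.
        index : + v′ ℤ.+ a ℤ.+ + v ≡ + (suc v ℕ.+ suc v′) ℤ.+ k ℤ.- + (x ℕ.+ y ℕ.+ 1)
        index = solveℤ 5 (λ v v′ k x y → v′ ⊹ (k ⊹ # (+ 1) ∸ x ∸ y) ⊹ v
            ≔ (# (+ 1) ⊹ v ⊹ (# (+ 1) ⊹ v′)) ⊹ k ∸ (x ⊹ y ⊹ # (+ 1)))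
          ≡.refl (+ v) (+ v′) k (+ x) (+ y)

    M-denom : ∀ y (V : Subset (x ℕ.+ y)) → ∣ V ∣ ≡ y →
              M R q qi h X Y k x y V * denom R q qi y ≈ Δ R q qi h X Y k x y V
    M-denom y V ∣V∣≡ = trans (*-congʳ (M-tilingSum y V ∣V∣≡))
      (trans (tilingSum-det y (toList V) (length-toList V)) (det-Δ y V ∣V∣≡))

no-tiling : ∀ x y (W : Subset (x Data.Nat.+ y)) → (0 < y ⊎ ∣ W ∣ ≡ 0) →
            ∣ W ∣ ≢ y → (ch : List Dir) → ¬ IsTiling x y W ch
-- Without columns the empty list of directions is a tiling for every `W`, so here the contradiction
-- comes from the cardinalities alone.
no-tiling x zero    W (inj₂ ∣W∣≡0) ∣W∣≢y _  _      = contradiction ∣W∣≡0 ∣W∣≢y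
no-tiling x (suc y) W _            ∣W∣≢y ch tiling = ∣W∣≢y (Columns.IsTiling⇒∣W∣ x y W ch tiling)

theoremA1 : {c ℓ : Level} (R : CommutativeRing c ℓ)
    → let open CommutativeRing R in
    (q qi h X Y : Carrier) → q * qi ≈ 1# → h + h ≈ 1#
    → (k : ℤ) (x y : ℕ) (W : Subset (x Data.Nat.+ y))
    → (0 < y ⊎ ∣ W ∣ ≡ 0)
    → ((∣ W ∣ ≢ y → (ch : List Dir) → ¬ IsTiling x y W ch)
    × (∣ W ∣ ≡ y → M R q qi h X Y k x y W * denom R q qi y ≈ Δ R q qi h X Y k x y W))
theoremA1 R q qi h X Y q*qi≈1 _ k x y W nonempty =
  no-tiling x y W nonempty , TilingSums.Tilings.M-denom R q qi h X Y q*qi≈1 k x y W
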